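{- Let $k,m$ be positive integers, let $G$ be a graph and let $X\subseteq V(G)$. Then $G$ has an $m$-tree-connected spanning subgraph $H$ such that for each $v\in X$, $$d_H(v)\le\begin{cases}\big\lceil\frac mk(d_G(v)-2m)\big\rceil+2m, & \text{if } G \text{ is } k\text{ -edge-connected and } k\ge2m;\\ \big\lceil\frac mk(d_G(v)-m)\big\rceil+m, & \text{if } G \text{ is } k\text{ -tree-connected and } k\ge m;\\ \big\lceil\frac mk d_G(v)\big\rceil+m, & \text{if } G \text{ is } k\text{ -edge-connected}, k\ge2m, \text{ and } X \text{ is independent};\\ \big\lceil\frac mk d_G(v)\big\rceil, & \text{if } G \text{ is } k\text{ -tree-connected}, k\ge m, \text{ and } X \text{ is independent}.\end{cases}$$ Furthermore, for a given arbitrary vertex $u\in X$, $H$ can be chosen so that the bound at $u$ is reduced to $d_H(u)\le\lfloor\frac mk d_G(u)\rfloor$.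
   Context: All graphs are finite, without loops, multiple edges allowed; degrees count multiple edges. A graph is $m$-tree-connected if it has $m$ edge-disjoint spanning trees. A vertex set is independent if no edge joins two of its vertices. -}

module Defs where

open import Data.Nat as ℕ using (ℕ; zero; suc; _∸_; NonZero)
open import Data.Integer as ℤ using (ℤ; +_; -_; _/ℕ_)
open import Data.Fin using (Fin; _≟_)
open import Data.Fin.Subset using (Subset; _∈_; _⊆_; _∩_; ∣_∣)
open import Data.Product using (Σ; _×_; _,_; proj₁; proj₂)
open import Data.Sum using (_⊎_)
open import Data.Bool using (Bool; true; false)
open import Data.Vec using (tabulate)
open import Relation.Binary.PropositionalEquality using (_≡_; _≢_)
open import Relation.Nullary using (¬_; does)

-- A finite loopless multigraph on vertex set Fin n.
-- Edges are indexed by Fin ne (so parallel edges are allowed);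
-- edge e has endpoints (proj₁ (ends e) , proj₂ (ends e)), which are distinct.
record Graph (n : ℕ) : Set where
  field
    ne       : ℕ
    ends     : Fin ne → Fin n × Fin n
    loopless : (e : Fin ne) → proj₁ (ends e) ≢ proj₂ (ends e)
open Graph public

-- Edge sets of G (spanning subgraphs of G are given by their edge sets).
EdgeSet : ∀ {n} → Graph n → Set
EdgeSet G = Subset (ne G)

Joins : ∀ {n} (G : Graph n) → Fin (ne G) → Fin n → Fin n → Set
Joins G e x y =
  (proj₁ (ends G e) ≡ x × proj₂ (ends G e) ≡ y) ⊎
  (proj₁ (ends G e) ≡ y × proj₂ (ends G e) ≡ x)

data Reach {n} (G : Graph n) (S : EdgeSet G) (x : Fin n) : Fin n → Set where
  here : Reach G S x x
  step : ∀ {y z} (e : Fin (ne G)) → e ∈ S → Joins G e y z →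
         Reach G S x y → Reach G S x z

Connected : ∀ {n} (G : Graph n) → EdgeSet G → Set
Connected G S = ∀ x y → Reach G S x y

SpanningTree : ∀ {n} (G : Graph n) → EdgeSet G → Set
SpanningTree {n} G T = Connected G T × ∣ T ∣ ≡ n ∸ 1

TreeConnected : ∀ {n} (G : Graph n) → ℕ → EdgeSet G → Set
TreeConnected G m S =
  Σ (Fin m → EdgeSet G) λ T →
    (∀ i → SpanningTree G (T i) × T i ⊆ S) ×
    (∀ i j e → e ∈ T i → e ∈ T j → i ≡ j)

allE : ∀ {n} (G : Graph n) → EdgeSet G
allE G = tabulate (λ _ → true)

minus : ∀ {n} (G : Graph n) → EdgeSet G → EdgeSet G
minus G F = tabulate (λ e → notIn e)
  where
  open import Data.Fin.Subset using (_∉_)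
  open import Data.Vec using (lookup)
  open import Data.Bool using (not)
  notIn : Fin (ne G) → Bool
  notIn e = not (lookup F e)

EdgeConnected : ∀ {n} (G : Graph n) → ℕ → Set
EdgeConnected G k = ∀ (F : EdgeSet G) → ∣ F ∣ ℕ.< k → Connected G (minus G F)

GTreeConnected : ∀ {n} (G : Graph n) → ℕ → Set
GTreeConnected G k = TreeConnected G k (allE G)

incident : ∀ {n} (G : Graph n) → Fin n → EdgeSet G
incident G v = tabulate (λ e → does (proj₁ (ends G e) ≟ v) Data.Bool.∨ does (proj₂ (ends G e) ≟ v))
  where import Data.Bool

-- Degree of v in the spanning subgraph (V(G), S) (G loopless, so each
-- incident edge counts once; parallel edges counted separately).
deg : ∀ {n} (G : Graph n) → EdgeSet G → Fin n → ℕ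
deg G S v = ∣ S ∩ incident G v ∣

Independent : ∀ {n} (G : Graph n) → Subset n → Set
Independent G X = ∀ e → ¬ (proj₁ (ends G e) ∈ X × proj₂ (ends G e) ∈ X)

⌈_/_⌉ : ℤ → (k : ℕ) → .{{NonZero k}} → ℤ
⌈ a / k ⌉ = - ((- a) /ℕ k)

data Case : Set where
  c1 c2 c3 c4 : Case

Hyp : ∀ {n} → Case → Graph n → ℕ → ℕ → Subset n → Set
Hyp c1 G k m X = EdgeConnected G k × 2 ℕ.* m ℕ.≤ k
Hyp c2 G k m X = GTreeConnected G k × m ℕ.≤ k
Hyp c3 G k m X = EdgeConnected G k × 2 ℕ.* m ℕ.≤ k × Independent G X
Hyp c4 G k m X = GTreeConnected G k × m ℕ.≤ k × Independent G X

Bound : Case → (k : ℕ) → .{{NonZero k}} → ℕ → ℕ → ℤ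
Bound c1 k m d = ⌈ + m ℤ.* (+ d ℤ.- + (2 ℕ.* m)) / k ⌉ ℤ.+ + (2 ℕ.* m)
Bound c2 k m d = ⌈ + m ℤ.* (+ d ℤ.- + m) / k ⌉ ℤ.+ + m
Bound c3 k m d = ⌈ + (m ℕ.* d) / k ⌉ ℤ.+ + m
Bound c4 k m d = ⌈ + (m ℕ.* d) / k ⌉

Good : ∀ {n} → Case → (G : Graph n) → (k : ℕ) → .{{NonZero k}} → ℕ → Subset n → EdgeSet G → Set
Good c G k m X H =
  TreeConnected G m H ×
  (∀ v → v ∈ X → + deg G H v ℤ.≤ Bound c k m (deg G (allE G) v))

{-# OPTIONS --safe #-}
-- Call an edge set H m-sparse if every nonempty vertex set A contains at most m(|A| − 1) edges of H, and call A tight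
-- if equality holds.  Tight sets with a common vertex are closed under ∪ and ∩, and the m-sparse sets with m(n − 1)
-- edges are the unions of m disjoint spanning trees (Nash-Williams).
--
-- Among these sets take H with the least total excess Σ max(0, d_H(v) − η(v)) over prescribed degree bounds η.  A tight
-- set is nice if none of its vertices exceeds its bound and the degree of each of them can be pushed strictly below the
-- bound by changing H only inside the set.  If an edge f ∉ H joins two disjoint nice sets, lower the degrees of both
-- ends of f and swap f for an edge of H in the least tight set Q containing f: either the excess drops, or the union of
-- the two nice sets with Q is nice.  So, if S is the set of vertices in no nice set, every edge outside H that avoids S
-- lies inside a class of a partition into tight sets in which the vertices of S are singletons, and d_H ≥ η on S.
-- Counting the edges of H and of G between the classes then contradicts the connectivity of G as soon as
-- d_H(v) > η(v) for some v.  One vertex above its bound is worth k in this count, so there is room for the loss of at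
-- most k − 1 caused by replacing a ceiling by a floor at the single vertex u.
--
-- The extremal arguments run under double negation; this is harmless because the existence of a suitable H together
-- with a partition into m sparse colour classes is decidable.
module Submission where

open import Defs
open import Data.Bool using (Bool; true; false; not; if_then_else_; _∧_; _∨_; _xor_)
open import Data.Bool.Properties using (∧-identityʳ; ∧-zeroʳ; ∨-identityʳ; ∨-zeroʳ; xor-same)
open import Data.Empty using (⊥; ⊥-elim)
open import Data.Fin using (Fin; zero; suc; _≟_; finToFun; funToFin; fromℕ<)
import Data.Fin.Properties as Fin
open import Data.Fin.Properties using (finToFun-funToFin)
open import Data.Fin.Subset using (Subset; ∣_∣) renaming (_∈_ to _∈ˢ_; _∩_ to _∩ˢ_)
open import Data.Fin.Subset.Properties using (anySubset?)
open import Data.Maybe as Maybe using (Maybe; just; nothing)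
open import Data.Maybe.Properties using (just-injective)
open import Data.Nat as ℕ
  using (ℕ; zero; suc; pred; _+_; _*_; _∸_; _/_; _%_; _^_; _≤_; _<_; z≤n; s≤s; NonZero)
open import Data.Nat.DivMod using (m≡m%n+[m/n]*n; m%n<n; m/n*n≤m; /-monoˡ-≤)
open import Data.Nat.Properties hiding (_≟_)
open import Data.Nat.Tactic.RingSolver using (solve-∀)
open import Data.Product using (Σ; ∃; _×_; _,_; proj₁; proj₂)
open import Data.Sum using (_⊎_; inj₁; inj₂)
open import Data.Vec as Vec using (lookup; tabulate)
open import Data.Vec.Properties using ([]=⇒lookup; lookup⇒[]=; lookup∘tabulate; lookup-zipWith)
open import Function using (_∘_)
open import Relation.Binary.PropositionalEquality
open import Relation.Nullary using (¬_; Dec; yes; no; does)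
open import Relation.Nullary.Decidable
  using (toWitness; dec-true; dec-false; ¬¬-excluded-middle; _→-dec_; _×-dec_; ¬?; decidable-stable)
open import Algebra.Properties.Semiring.Sum +-*-semiring
  using (sum; sum-cong-≗; ∑-distrib-+; ∑-comm; *-distribˡ-sum)

-- Reasoning under double negation and minimal choices.

_>>=_ : {A B : Set} → ¬ ¬ A → (A → ¬ ¬ B) → ¬ ¬ B
(m >>= f) k = m λ a → f a k

pure : {A : Set} → A → ¬ ¬ A
pure a k = k a

em : (A : Set) → ¬ ¬ Dec A
em A = ¬¬-excluded-middle

¬¬-∀Fin : ∀ {n} {P : Fin n → Set} → (∀ i → ¬ ¬ P i) → ¬ ¬ (∀ i → P i)
¬¬-∀Fin {zero}  f = pure λ ()
¬¬-∀Fin {suc n} f = do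
  p ← f zero
  q ← ¬¬-∀Fin (f ∘ suc)
  pure λ { zero → p ; (suc i) → q i }

module _ {X : Set} (P : X → Set) (f : X → ℕ) where
  Minimal : X → Set
  Minimal x = P x × (∀ y → P y → f x ≤ f y)

  -- Strong induction on the measure. Whether a smaller value exists is settled by excluded middle,
  -- so the minimiser is obtained only under double negation.
  argmin : ∀ x → P x → ¬ ¬ ∃ Minimal
  argmin x px = go (suc (f x)) x px ≤-refl
    where
    go : ∀ N x → P x → f x < N → ¬ ¬ ∃ Minimal
    go (suc N) x px (s≤s fx≤N) = do
      no ¬smaller ← em (∃ λ y → P y × f y < f x)
        where yes (y , py , fy<fx) → go N y py (<-≤-trans fy<fx fx≤N)
      pure (x , px , λ y py → ≮⇒≥ λ fy<fx → ¬smaller (y , py , fy<fx))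

-- Booleans, with identities verified by running through all truth values.

∀Bool? : {P : Bool → Set} → (∀ b → Dec (P b)) → Dec (∀ b → P b)
∀Bool? {P} P? with P? true | P? false
... | yes p | yes q = yes λ { true → p ; false → q }
... | no ¬p | _     = no λ f → ¬p (f true)
... | _     | no ¬q = no λ f → ¬q (f false)

bool-contra : {A : Set} {b : Bool} → b ≡ true → b ≡ false → A
bool-contra refl ()

¬true⇒false : ∀ {b} → ¬ b ≡ true → b ≡ false
¬true⇒false {true}  h = ⊥-elim (h refl)
¬true⇒false {false} _ = refl

∧-true : ∀ {a b} → a ≡ true → b ≡ true → a ∧ b ≡ true
∧-true refl refl = refl

∧-trueˡ : ∀ {a b} → a ∧ b ≡ true → a ≡ true
∧-trueˡ {true} _ = refl

∧-trueʳ : ∀ {a b} → a ∧ b ≡ true → b ≡ true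
∧-trueʳ {true} h = h

∨-trueˡ : ∀ {a b} → a ≡ true → a ∨ b ≡ true
∨-trueˡ refl = refl

∨-trueʳ : ∀ {a b} → b ≡ true → a ∨ b ≡ true
∨-trueʳ {a} refl = ∨-zeroʳ a

∨-split : ∀ {a b} → a ∨ b ≡ true → a ≡ true ⊎ b ≡ true
∨-split {true}  _ = inj₁ refl
∨-split {false} h = inj₂ h

not-true : ∀ {b} → not b ≡ true → b ≡ false
not-true {false} _ = refl

not-false : ∀ {b} → not b ≡ false → b ≡ true
not-false {true} _ = refl

not-∨ˡ : ∀ a {b} → not (a ∨ b) ≡ true → not a ≡ true
not-∨ˡ false _ = refl

∧-cong-on : ∀ {a b} c → (c ≡ true → a ≡ b) → a ∧ c ≡ b ∧ c
∧-cong-on         true  h = cong (_∧ true) (h refl)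
∧-cong-on {a} {b} false h = trans (∧-zeroʳ a) (sym (∧-zeroʳ b))

does-true : {A : Set} (d : Dec A) → does d ≡ true → A
does-true (yes a) _ = a

does-false : {A : Set} (d : Dec A) → does d ≡ false → ¬ A
does-false (no ¬a) _ = ¬a

fromDec : {n : ℕ} {P : Fin n → Set} → (∀ i → Dec (P i)) → Fin n → Bool
fromDec P? i = does (P? i)

ι : Bool → ℕ
ι true  = 1
ι false = 0

ι-mono : ∀ {a b} → (a ≡ true → b ≡ true) → ι a ≤ ι b
ι-mono {true}  h rewrite h refl = ≤-refl
ι-mono {false} _ = z≤n

_⇉_ : ∀ {n} → (Fin n → Bool) → (Fin n → Bool) → Set
A ⇉ B = ∀ v → A v ≡ true → B v ≡ true

_∪_ _∩_ : ∀ {n} → (Fin n → Bool) → (Fin n → Bool) → Fin n → Bool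
(A ∪ B) v = A v ∨ B v
(A ∩ B) v = A v ∧ B v

-- Opaque so that unification can recover the summand from a sum.
opaque
  ∑ : ∀ {n} → (Fin n → ℕ) → ℕ
  ∑ = sum

  cnt : ∀ {n} → (Fin n → Bool) → ℕ
  cnt p = ∑ (ι ∘ p)

opaque
  unfolding ∑ cnt

  cnt-∑ : ∀ {n} (p : Fin n → Bool) → cnt p ≡ ∑ (ι ∘ p)
  cnt-∑ p = refl

  ∑-zero : (f : Fin 0 → ℕ) → ∑ f ≡ 0
  ∑-zero f = refl

  cnt-suc : ∀ {n} (p : Fin (suc n) → Bool) → cnt p ≡ ι (p zero) + cnt (p ∘ suc)
  cnt-suc p = refl

  ∑-cong : ∀ {n} {f g : Fin n → ℕ} → (∀ i → f i ≡ g i) → ∑ f ≡ ∑ g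
  ∑-cong = sum-cong-≗

  ∑-swap : ∀ {m n} (f : Fin m → Fin n → ℕ) → ∑ (λ i → ∑ (f i)) ≡ ∑ (λ j → ∑ λ i → f i j)
  ∑-swap = ∑-comm

  ∑-mono : ∀ {n} {f g : Fin n → ℕ} → (∀ i → f i ≤ g i) → ∑ f ≤ ∑ g
  ∑-mono {zero}  h = z≤n
  ∑-mono {suc n} h = +-mono-≤ (h zero) (∑-mono (h ∘ suc))

  ∑-mono-< : ∀ {n} {f g : Fin n → ℕ} → (∀ i → f i ≤ g i) → ∀ i → f i < g i → ∑ f < ∑ g
  ∑-mono-< h zero    f<g = +-mono-<-≤ f<g (∑-mono (h ∘ suc))
  ∑-mono-< h (suc i) f<g = +-mono-≤-< (h zero) (∑-mono-< (h ∘ suc) i f<g)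

  ∑-const : ∀ n c → ∑ {n} (λ _ → c) ≡ n * c
  ∑-const zero    c = refl
  ∑-const (suc n) c = cong (c +_) (∑-const n c)

  ∑-+ : ∀ {n} (f g : Fin n → ℕ) → ∑ (λ i → f i + g i) ≡ ∑ f + ∑ g
  ∑-+ = ∑-distrib-+

  ∑-* : ∀ {n} c (f : Fin n → ℕ) → ∑ (λ i → c * f i) ≡ c * ∑ f
  ∑-* c f = sym (*-distribˡ-sum c f)

cnt-cong : ∀ {n} {p q : Fin n → Bool} → (∀ i → p i ≡ q i) → cnt p ≡ cnt q
cnt-cong {p = p} {q} h = trans (cnt-∑ p) (trans (∑-cong (cong ι ∘ h)) (sym (cnt-∑ q)))

cnt-mono : ∀ {n} {p q : Fin n → Bool} → p ⇉ q → cnt p ≤ cnt q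
cnt-mono {p = p} {q} h = subst₂ _≤_ (sym (cnt-∑ p)) (sym (cnt-∑ q)) (∑-mono λ i → ι-mono (h i))

cnt-zero : ∀ {n} {p : Fin n → Bool} → (∀ i → p i ≡ false) → cnt p ≡ 0
cnt-zero {n} {p} h = begin
  cnt p               ≡⟨ cnt-∑ p ⟩
  ∑ (ι ∘ p)           ≡⟨ ∑-cong (cong ι ∘ h) ⟩
  ∑ {n} (λ _ → 0)     ≡⟨ ∑-const n 0 ⟩
  n * 0               ≡⟨ *-zeroʳ n ⟩
  0                   ∎
  where open ≡-Reasoning

cnt-all : ∀ n → cnt {n} (λ _ → true) ≡ n
cnt-all n = trans (cnt-∑ _) (trans (∑-const n 1) (*-identityʳ n))

-- An element of `q` outside `p` would make one count strictly larger. Extremal choices of sets are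
-- exploited through this.
cnt-reflects-⇉ : ∀ {n} {p q : Fin n → Bool} → p ⇉ q → cnt q ≤ cnt p → q ⇉ p
cnt-reflects-⇉ {p = p} {q} p⇉q q≤p i qi with p i in pi
... | true  = refl
... | false = ⊥-elim (<⇒≱ (subst₂ _<_ (sym (cnt-∑ p)) (sym (cnt-∑ q))
        (∑-mono-< (λ j → ι-mono (p⇉q j)) i (subst₂ (λ a b → ι a < ι b) (sym pi) (sym qi) (s≤s z≤n)))) q≤p)

cnt-singleton : ∀ {n} (i : Fin n) (q : Fin n → Bool) → cnt (λ j → does (i ≟ j) ∧ q j) ≡ ι (q i)
cnt-singleton zero    q = trans (cnt-suc _) (trans (cong (ι (q zero) +_) (cnt-zero λ _ → refl)) (+-identityʳ _))
cnt-singleton (suc i) q = trans (cnt-suc _) (cnt-singleton i (q ∘ suc))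

cnt-pos⁻¹ : ∀ {n} (p : Fin n → Bool) → 0 < cnt p → ∃ λ i → p i ≡ true
cnt-pos⁻¹ p 0<p with Fin.any? (λ i → p i Data.Bool.≟ true)
... | yes ∃p = ∃p
... | no ¬∃p = ⊥-elim (<⇒≢ 0<p (sym (cnt-zero λ i → ¬true⇒false λ pi → ¬∃p (i , pi))))

cnt-pos : ∀ {n} {p : Fin n → Bool} i → p i ≡ true → 0 < cnt p
cnt-pos {p = p} i pi = subst (_≤ cnt p) (trans (cnt-singleton i p) (cong ι pi)) (cnt-mono λ j → ∧-trueʳ {does (i ≟ j)})

cnt≤1 : ∀ {n} (p : Fin n → Bool) → (∀ i j → p i ≡ true → p j ≡ true → i ≡ j) → cnt p ≤ 1
cnt≤1 p h with 1 ℕ.≤? cnt p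
... | no ¬1≤  = <⇒≤ (≰⇒> ¬1≤)
... | yes 1≤ with cnt-pos⁻¹ p 1≤
...   | i , pi = ≤-trans (cnt-mono λ j pj → ∧-true (dec-true (i ≟ j) (h i j pi pj)) pj)
                   (≤-reflexive (trans (cnt-singleton i p) (cong ι pi)))

∑-+-cong : ∀ {n} {f g h k : Fin n → ℕ} → (∀ i → f i + g i ≡ h i + k i) → ∑ f + ∑ g ≡ ∑ h + ∑ k
∑-+-cong {f = f} {g} {h} {k} e = trans (sym (∑-+ f g)) (trans (∑-cong e) (∑-+ h k))

cnt-+-cong : ∀ {n} {f g h k : Fin n → Bool} → (∀ i → ι (f i) + ι (g i) ≡ ι (h i) + ι (k i)) →
             cnt f + cnt g ≡ cnt h + cnt k
cnt-+-cong {f = f} {g} {h} {k} e =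
  trans (cong₂ _+_ (cnt-∑ f) (cnt-∑ g)) (trans (∑-+-cong e) (sym (cong₂ _+_ (cnt-∑ h) (cnt-∑ k))))

cnt-+ : ∀ {n} {f g h : Fin n → Bool} → (∀ i → ι (f i) ≡ ι (g i) + ι (h i)) → cnt f ≡ cnt g + cnt h
cnt-+ {f = f} {g} {h} e = begin
  cnt f                               ≡⟨ cnt-∑ f ⟩
  ∑ (ι ∘ f)                           ≡⟨ ∑-cong e ⟩
  ∑ (λ i → ι (g i) + ι (h i))         ≡⟨ ∑-+ (ι ∘ g) (ι ∘ h) ⟩
  ∑ (ι ∘ g) + ∑ (ι ∘ h)               ≡⟨ cong₂ _+_ (cnt-∑ g) (cnt-∑ h) ⟨
  cnt g + cnt h                       ∎
  where open ≡-Reasoning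

cnt-+-mono : ∀ {n} {f g h k : Fin n → Bool} → (∀ i → ι (f i) + ι (g i) ≤ ι (h i) + ι (k i)) →
             cnt f + cnt g ≤ cnt h + cnt k
cnt-+-mono {f = f} {g} {h} {k} e = begin
  cnt f + cnt g                       ≡⟨ cong₂ _+_ (cnt-∑ f) (cnt-∑ g) ⟩
  ∑ (ι ∘ f) + ∑ (ι ∘ g)               ≡⟨ ∑-+ (ι ∘ f) (ι ∘ g) ⟨
  ∑ (λ i → ι (f i) + ι (g i))         ≤⟨ ∑-mono e ⟩
  ∑ (λ i → ι (h i) + ι (k i))         ≡⟨ ∑-+ (ι ∘ h) (ι ∘ k) ⟩
  ∑ (ι ∘ h) + ∑ (ι ∘ k)               ≡⟨ cong₂ _+_ (cnt-∑ h) (cnt-∑ k) ⟨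
  cnt h + cnt k                       ∎
  where open ≤-Reasoning

cnt-+-+-cong : ∀ {n} {f g h k l : Fin n → Bool} → (∀ i → ι (f i) + ι (g i) + ι (h i) ≡ ι (k i) + ι (l i)) →
               cnt f + cnt g + cnt h ≡ cnt k + cnt l
cnt-+-+-cong {f = f} {g} {h} {k} {l} e = begin
  cnt f + cnt g + cnt h                     ≡⟨ cong₂ _+_ (cong₂ _+_ (cnt-∑ f) (cnt-∑ g)) (cnt-∑ h) ⟩
  ∑ (ι ∘ f) + ∑ (ι ∘ g) + ∑ (ι ∘ h)         ≡⟨ cong (_+ _) (∑-+ (ι ∘ f) (ι ∘ g)) ⟨
  ∑ (λ i → ι (f i) + ι (g i)) + ∑ (ι ∘ h)   ≡⟨ ∑-+-cong e ⟩
  ∑ (ι ∘ k) + ∑ (ι ∘ l)                     ≡⟨ cong₂ _+_ (cnt-∑ k) (cnt-∑ l) ⟨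
  cnt k + cnt l                             ∎
  where open ≡-Reasoning

cnt-split : ∀ {n} (p q : Fin n → Bool) → cnt p ≡ cnt (λ i → p i ∧ q i) + cnt (λ i → p i ∧ not (q i))
cnt-split p q = cnt-+ λ i → bool (p i) (q i)
  where
  bool : ∀ a b → ι a ≡ ι (a ∧ b) + ι (a ∧ not b)
  bool = toWitness {a? = ∀Bool? λ a → ∀Bool? λ b → ι a ℕ.≟ _} _

cnt-∪-∩ : ∀ {n} (A B : Fin n → Bool) → cnt A + cnt B ≡ cnt (A ∪ B) + cnt (A ∩ B)
cnt-∪-∩ A B = cnt-+-cong λ v → bool (A v) (B v)
  where
  bool : ∀ a b → ι a + ι b ≡ ι (a ∨ b) + ι (a ∧ b)
  bool = toWitness {a? = ∀Bool? λ a → ∀Bool? λ b → ι a + ι b ℕ.≟ _} _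

-- A Farkas-style step: a ≤ b follows from l ≤ r once b − a = (r − l) + w.
linear : ∀ {a b l r} w → l ≤ r → a + r + w ≡ b + l → a ≤ b
linear {a} {b} {l} {r} w l≤r eq = +-cancelʳ-≤ r a b (begin
  a + r       ≤⟨ m≤m+n _ w ⟩
  a + r + w   ≡⟨ eq ⟩
  b + l       ≤⟨ +-monoʳ-≤ b l≤r ⟩
  b + r       ∎)
  where open ≤-Reasoning

-- Sparse and tight sets.

module Sparsity {n} (G : Graph n) where
  VSet ESet : Set
  VSet = Fin n → Bool
  ESet = Fin (ne G) → Bool

  src tgt : Fin (ne G) → Fin n
  src e = proj₁ (ends G e)
  tgt e = proj₂ (ends G e)

  ins : VSet → ESet
  ins A e = A (src e) ∧ A (tgt e)

  opaque
    E : ESet → VSet → ℕ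
    E H A = cnt λ e → H e ∧ ins A e

  -- The term `m` stands on the left to avoid truncated subtraction, and the vertex `v` witnesses
  -- that `A` is nonempty.
  Sparse : ℕ → ESet → Set
  Sparse m H = ∀ A v → A v ≡ true → E H A + m ≤ m * cnt A

  Tight : ℕ → ESet → VSet → Set
  Tight m H A = m * cnt A ≤ E H A + m

  ins-mono : ∀ {A B} → A ⇉ B → ins A ⇉ ins B
  ins-mono {A} A⇉B e h = ∧-true (A⇉B _ (∧-trueˡ {A (src e)} h)) (A⇉B _ (∧-trueʳ {A (src e)} h))

  insert remove : Fin (ne G) → ESet → ESet
  insert f H e = H e ∨ does (f ≟ e)
  remove f H e = H e ∧ not (does (f ≟ e))

  swap : Fin (ne G) → Fin (ne G) → ESet → ESet
  swap f e H = insert f (remove e H)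

  splice : VSet → ESet → ESet → ESet
  splice C K H e = if ins C e then K e else H e

  opaque
    unfolding E

    E-def : ∀ H A → E H A ≡ cnt (λ e → H e ∧ ins A e)
    E-def H A = refl

    E-cong : ∀ {H K A B} → (∀ e → H e ≡ K e) → (∀ v → A v ≡ B v) → E H A ≡ E K B
    E-cong h a = cnt-cong λ e → cong₂ _∧_ (h e) (cong₂ _∧_ (a (src e)) (a (tgt e)))

    Sparse-cong : ∀ {m H K} → (∀ e → H e ≡ K e) → Sparse m H → Sparse m K
    Sparse-cong {m} {H} {K} h sp A v v∈A =
      subst (λ z → z + m ≤ m * cnt A) (E-cong {H} {K} {A} h (λ _ → refl)) (sp A v v∈A)

    Tight-cong : ∀ {m H K A B} → (∀ e → H e ≡ K e) → (∀ v → A v ≡ B v) → Tight m H A → Tight m K B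
    Tight-cong {m} {H} {K} {A} {B} h a t =
      subst₂ (λ x y → m * x ≤ y + m) (cnt-cong a) (E-cong {H} {K} {A} {B} h a) t

    Sparse-mono : ∀ {m H K} → K ⇉ H → Sparse m H → Sparse m K
    Sparse-mono {m} {H} {K} K⇉H sp A v v∈A =
      ≤-trans (+-monoˡ-≤ m (cnt-mono λ e h → ∧-true (K⇉H e (∧-trueˡ {K e} h)) (∧-trueʳ {K e} h))) (sp A v v∈A)

    Sparse-tight : ∀ {m H A v} → Sparse m H → Tight m H A → A v ≡ true → E H A + m ≡ m * cnt A
    Sparse-tight {A = A} {v} sp t v∈A = ≤-antisym (sp A v v∈A) t

  module _ {m : ℕ} {H : ESet} {A B : VSet} {v : Fin n} (sp : Sparse m H) (tA : Tight m H A) (tB : Tight m H B)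
           (v∈A : A v ≡ true) (v∈B : B v ≡ true) where
    opaque
      unfolding E

      private
        between : ESet
        between e = H e ∧ ins (A ∪ B) e ∧ not (ins A e) ∧ not (ins B e)

        edges : E H A + E H B + cnt between ≡ E H (A ∪ B) + E H (A ∩ B)
        edges = cnt-+-+-cong λ e → bool (H e) (A (src e)) (A (tgt e)) (B (src e)) (B (tgt e))
          where
          bool : ∀ h a a′ b b′ →
            ι (h ∧ a ∧ a′) + ι (h ∧ b ∧ b′) + ι (h ∧ ((a ∨ b) ∧ (a′ ∨ b′)) ∧ not (a ∧ a′) ∧ not (b ∧ b′))
            ≡ ι (h ∧ (a ∨ b) ∧ (a′ ∨ b′)) + ι (h ∧ (a ∧ b) ∧ (a′ ∧ b′))
          bool = toWitness {a? = ∀Bool? λ h → ∀Bool? λ a → ∀Bool? λ a′ → ∀Bool? λ b → ∀Bool? λ b′ → _ ℕ.≟ _} _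

        vertices : cnt A + cnt B ≡ cnt (A ∪ B) + cnt (A ∩ B)
        vertices = cnt-∪-∩ A B

        arith : ∀ {a b u i ea eb eu ei x} → m * a ≤ ea + m → m * b ≤ eb + m → ei + m ≤ m * i →
                a + b ≡ u + i → ea + eb + x ≡ eu + ei → m * u + x ≤ eu + m
        arith {a} {b} {u} {i} {ea} {eb} {eu} {ei} {x} ha hb hi hv he =
          linear 0 (+-mono-≤ (+-mono-≤ (+-mono-≤ ha hb) hi) (+-mono-≤ (≤-reflexive (sym (cong (m *_) hv))) (≤-reflexive he)))
            (id m a b u i ea eb eu ei x)
          where
          id : ∀ m a b u i ea eb eu ei x →
            m * u + x + (ea + m + (eb + m) + m * i + (m * (a + b) + (eu + ei))) + 0
            ≡ eu + m + (m * a + m * b + (ei + m) + (m * (u + i) + (ea + eb + x)))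
          id = solve-∀

        -- Uncrossing: add the tightness of `A` and of `B` and use the sparsity bound of `A ∩ B`.
        -- The edges inside the union but inside neither set are kept as a surplus.
        ∪-slack : m * cnt (A ∪ B) + cnt between ≤ E H (A ∪ B) + m
        ∪-slack = arith tA tB (sp (A ∩ B) v (∧-true v∈A v∈B)) vertices edges

      Tight-∪ : Tight m H (A ∪ B)
      Tight-∪ = ≤-trans (m≤m+n _ _) ∪-slack

      Tight-∩ : Tight m H (A ∩ B)
      Tight-∩ = arith′ tA tB (sp (A ∪ B) v (∨-trueˡ v∈A)) vertices edges
        where
        arith′ : ∀ {a b u i ea eb eu ei x} → m * a ≤ ea + m → m * b ≤ eb + m → eu + m ≤ m * u →
                a + b ≡ u + i → ea + eb + x ≡ eu + ei → m * i ≤ ei + m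
        arith′ {a} {b} {u} {i} {ea} {eb} {eu} {ei} {x} ha hb hi hv he =
          ≤-trans (m≤m+n _ x) (arith ha hb hi (trans hv (+-comm u i)) (trans he (+-comm eu ei)))

      -- Sparsity of the union forces the surplus in `∪-slack` to vanish.
      edge-in-∪ : ∀ e → H e ≡ true → ins (A ∪ B) e ≡ true → ins A e ≡ true ⊎ ins B e ≡ true
      edge-in-∪ e e∈H e∈∪ with ins A e in eA | ins B e in eB
      ... | true  | _    = inj₁ refl
      ... | false | true = inj₂ refl
      ... | false | false = ⊥-elim (<⇒≱ (cnt-pos {p = between} e
              (∧-true e∈H (∧-true e∈∪ (cong₂ (λ a b → not a ∧ not b) eA eB))))
              (+-cancelˡ-≤ (m * cnt (A ∪ B)) _ _ (≤-trans ∪-slack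
                (subst (E H (A ∪ B) + m ≤_) (sym (+-identityʳ _)) (sp (A ∪ B) v (∨-trueˡ v∈A))))))

  opaque
    unfolding E

    Sparse-∅ : ∀ {m} → Sparse m (λ _ → false)
    Sparse-∅ {m} A v v∈A = subst₂ (λ z w → z + m ≤ w) (sym (cnt-zero λ _ → refl)) refl
      (subst (_≤ m * cnt A) (*-identityʳ m) (*-monoʳ-≤ m (cnt-pos v v∈A)))

    cnt-insert : ∀ {f} H (q : ESet) → H f ≡ false →
                 cnt (λ i → insert f H i ∧ q i) ≡ cnt (λ i → H i ∧ q i) + ι (q f)
    cnt-insert {f} H q f∉H =
      trans (cnt-+ λ i → bool (H i) (does (f ≟ i)) (q i) (disjoint i)) (cong (_ +_) (cnt-singleton f q))
      where
      bool : ∀ h d q → h ∧ d ≡ false → ι ((h ∨ d) ∧ q) ≡ ι (h ∧ q) + ι (d ∧ q)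
      bool true  false q _ = sym (+-identityʳ _)
      bool false d     q _ = refl
      disjoint : ∀ i → H i ∧ does (f ≟ i) ≡ false
      disjoint i = ¬true⇒false λ h →
        bool-contra (∧-trueˡ {H i} h) (trans (cong H (sym (does-true (f ≟ i) (∧-trueʳ {H i} h)))) f∉H)

    cnt-remove : ∀ {f} H (q : ESet) → H f ≡ true →
                 cnt (λ i → remove f H i ∧ q i) + ι (q f) ≡ cnt (λ i → H i ∧ q i)
    cnt-remove {f} H q f∈H = trans (sym (cnt-insert (remove f H) q f∉)) (cnt-cong λ i → cong (_∧ q i) (restore i))
      where
      f∉ : remove f H f ≡ false
      f∉ rewrite dec-true (f ≟ f) refl | f∈H = refl
      restore : ∀ i → insert f (remove f H) i ≡ H i
      restore i with f ≟ i
      ... | yes refl rewrite f∈H = refl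
      ... | no _ with H i
      ...   | true  = refl
      ...   | false = refl

    E-remove : ∀ {f} H A → H f ≡ true → E (remove f H) A + ι (ins A f) ≡ E H A
    E-remove H A = cnt-remove H (ins A)

    -- One additional edge can overfill only a set that already attains its bound.
    Sparse-insert : ∀ {m H f} → Sparse m H → H f ≡ false →
                    (∀ A → Tight m H A → ¬ ins A f ≡ true) → Sparse m (insert f H)
    Sparse-insert {m} {H} {f} sp f∉H ¬tight A v v∈A
      rewrite cnt-insert H (ins A) f∉H with ins A f in eq
    ... | false rewrite +-identityʳ (E H A) = sp A v v∈A
    ... | true  = subst (_≤ m * cnt A) (trans (sym (+-comm _ 1)) (arith (E H A) m)) (≰⇒> λ t → ¬tight A t eq)
      where
      arith : ∀ e m → e + m + 1 ≡ e + 1 + m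
      arith = solve-∀

  module _ {H : ESet} {f e : Fin (ne G)} (f∉H : H f ≡ false) (e∈H : H e ≡ true) where
    opaque
      unfolding E

      cnt-swap : ∀ (q : ESet) → cnt (λ i → swap f e H i ∧ q i) + ι (q e) ≡ cnt (λ i → H i ∧ q i) + ι (q f)
      cnt-swap q = begin
        cnt (λ i → swap f e H i ∧ q i) + ι (q e)               ≡⟨ cong (_+ ι (q e)) (cnt-insert (remove e H) q f∉) ⟩
        cnt (λ i → remove e H i ∧ q i) + ι (q f) + ι (q e)     ≡⟨ comm _ (ι (q f)) (ι (q e)) ⟩
        cnt (λ i → remove e H i ∧ q i) + ι (q e) + ι (q f)     ≡⟨ cong (_+ ι (q f)) (cnt-remove H q e∈H) ⟩
        cnt (λ i → H i ∧ q i) + ι (q f)                        ∎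
        where
        open ≡-Reasoning
        f∉ : remove e H f ≡ false
        f∉ = cong (_∧ _) f∉H
        comm : ∀ a b c → a + b + c ≡ a + c + b
        comm = solve-∀

      E-swap : ∀ A → E (swap f e H) A + ι (ins A e) ≡ E H A + ι (ins A f)
      E-swap A = cnt-swap (ins A)

      -- A tight set that gains `f` loses `e`, and a set that is not tight has room for one more
      -- edge.
      Sparse-swap : ∀ {m} → Sparse m H → (∀ A → Tight m H A → ins A f ≡ true → ins A e ≡ true) →
                    Sparse m (swap f e H)
      Sparse-swap {m} sp tight∋e A v v∈A with ins A f in eqf | ins A e in eqe | cnt-swap (ins A)
      ... | false | _     | eq = ≤-trans (+-monoˡ-≤ m (≤-trans (m≤m+n _ _) (≤-reflexive (trans eq (+-identityʳ _))))) (sp A v v∈A)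
      ... | true  | true  | eq = subst (λ z → z + m ≤ m * cnt A) (sym (+-cancelʳ-≡ 1 _ _ eq)) (sp A v v∈A)
      ... | true  | false | eq = subst (_≤ m * cnt A) (trans (arith (E H A) m) (cong (_+ m) (trans (sym eq) (+-identityʳ _))))
                                   (≰⇒> λ t → bool-contra (tight∋e A t eqf) eqe)
        where
        arith : ∀ e m → suc (e + m) ≡ e + 1 + m
        arith = solve-∀

  opaque
    unfolding E

    -- If `A` meets `C`, then supermodularity of the edge count and tightness of `C` bound the edges
    -- of `H` in `A` but not in `A ∩ C` by the sparsity of `A ∪ C`. The edges in `A ∩ C` are now
    -- those of `K`, which is sparse as well.
    Sparse-splice : ∀ {m H K C} → Sparse m H → Sparse m K → Tight m H C → Sparse m (splice C K H)
    Sparse-splice {m} {H} {K} {C} spH spK tC A v v∈A with Fin.any? (λ w → (A ∩ C) w Data.Bool.≟ true)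
    ... | no ¬meet = ≤-trans (+-monoˡ-≤ m (cnt-mono λ e h → inH e h)) (spH A v v∈A)
      where
      inH : ∀ e → splice C K H e ∧ ins A e ≡ true → H e ∧ ins A e ≡ true
      inH e h with ins C e in eq
      ... | false = h
      ... | true  = ⊥-elim (¬meet (src e , ∧-true (∧-trueˡ {A (src e)} (∧-trueʳ {K e} h)) (∧-trueˡ {C (src e)} eq)))
    ... | yes (w , w∈) = arith tC (spK (A ∩ C) w w∈) (spH (A ∪ C) v (∨-trueˡ v∈A)) vertices edges splice-edges
      where
      edges : E H A + E H C ≤ E H (A ∪ C) + E H (A ∩ C)
      edges = cnt-+-mono λ e → bool (H e) (A (src e)) (A (tgt e)) (C (src e)) (C (tgt e))
        where
        bool : ∀ h a a′ b b′ →
          ι (h ∧ a ∧ a′) + ι (h ∧ b ∧ b′) ≤ ι (h ∧ (a ∨ b) ∧ (a′ ∨ b′)) + ι (h ∧ (a ∧ b) ∧ (a′ ∧ b′))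
        bool = toWitness {a? = ∀Bool? λ h → ∀Bool? λ a → ∀Bool? λ a′ → ∀Bool? λ b → ∀Bool? λ b′ → _ ℕ.≤? _} _

      vertices : cnt A + cnt C ≡ cnt (A ∪ C) + cnt (A ∩ C)
      vertices = cnt-∪-∩ A C

      splice-edges : E (splice C K H) A + E H (A ∩ C) ≡ E H A + E K (A ∩ C)
      splice-edges = cnt-+-cong λ e → bool (H e) (K e) (A (src e)) (A (tgt e)) (C (src e)) (C (tgt e))
        where
        bool : ∀ h k a a′ c c′ →
          ι ((if c ∧ c′ then k else h) ∧ a ∧ a′) + ι (h ∧ (a ∧ c) ∧ (a′ ∧ c′)) ≡ ι (h ∧ a ∧ a′) + ι (k ∧ (a ∧ c) ∧ (a′ ∧ c′))
        bool = toWitness {a? = ∀Bool? λ h → ∀Bool? λ k → ∀Bool? λ a → ∀Bool? λ a′ → ∀Bool? λ c → ∀Bool? λ c′ → _ ℕ.≟ _} _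

      arith : ∀ {a c u i ea ec eu ei ki s} → m * c ≤ ec + m → ki + m ≤ m * i → eu + m ≤ m * u →
              a + c ≡ u + i → ea + ec ≤ eu + ei → s + ei ≡ ea + ki → s + m ≤ m * a
      arith {a} {c} {u} {i} {ea} {ec} {eu} {ei} {ki} {s} h1 h2 h3 h4 h5 h6 =
        linear 0 (+-mono-≤ (+-mono-≤ (+-mono-≤ h1 h2) h3)
          (+-mono-≤ (+-mono-≤ (≤-reflexive (sym (cong (m *_) h4))) h5) (≤-reflexive h6)))
          (id m a c u i ea ec eu ei ki s)
        where
        id : ∀ m a c u i ea ec eu ei ki s →
          s + m + (ec + m + m * i + m * u + (m * (a + c) + (eu + ei) + (ea + ki))) + 0
          ≡ m * a + (m * c + (ki + m) + (eu + m) + (m * (u + i) + (ea + ec) + (s + ei)))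
        id = solve-∀

    -- The two nonempty parts of `Q` contain together at most m|Q| - 2m edges, while `Q` contains
    -- m|Q| - m, so at least `m` edges run between the parts.
    crossing-edge : ∀ {m H} {Q B : VSet} {v w} → .{{NonZero m}} → Sparse m H → Tight m H Q →
      Q v ≡ true → B v ≡ true → Q w ≡ true → B w ≡ false →
      ∃ λ e → H e ≡ true × ins Q e ≡ true × B (src e) xor B (tgt e) ≡ true
    crossing-edge {m} {H} {Q} {B} {v} {w} sp tQ v∈Q v∈B w∈Q w∉B =
      let e , h = cnt-pos⁻¹ cross (pos (sp Q∩B v (∧-true v∈Q v∈B)) (sp Q∖B w (∧-true w∈Q (cong not w∉B))) tQ)
      in e , ∧-trueˡ {H e} h , ∧-trueˡ {ins Q e} (∧-trueʳ {H e} h) , ∧-trueʳ {ins Q e} (∧-trueʳ {H e} h)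
      where
      cross : ESet
      cross e = H e ∧ ins Q e ∧ (B (src e) xor B (tgt e))
      Q∩B Q∖B : VSet
      Q∩B u = Q u ∧ B u
      Q∖B u = Q u ∧ not (B u)

      edges : E H Q∩B + E H Q∖B + cnt cross ≡ E H Q + 0
      edges = trans (cnt-+-+-cong {l = λ (_ : Fin (ne G)) → false} λ e → bool (H e) (Q (src e)) (Q (tgt e)) (B (src e)) (B (tgt e)))
        (cong (E H Q +_) (cnt-zero λ _ → refl))
        where
        bool : ∀ h a a′ b b′ →
          ι (h ∧ (a ∧ b) ∧ (a′ ∧ b′)) + ι (h ∧ (a ∧ not b) ∧ (a′ ∧ not b′)) + ι (h ∧ (a ∧ a′) ∧ (b xor b′))
          ≡ ι (h ∧ a ∧ a′) + 0
        bool = toWitness {a? = ∀Bool? λ h → ∀Bool? λ a → ∀Bool? λ a′ → ∀Bool? λ b → ∀Bool? λ b′ → _ ℕ.≟ _} _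

      pos : E H Q∩B + m ≤ m * cnt Q∩B → E H Q∖B + m ≤ m * cnt Q∖B → m * cnt Q ≤ E H Q + m → 0 < cnt cross
      pos h1 h2 h3 = ≤-trans (ℕ.>-nonZero⁻¹ m) (linear 0
        (+-mono-≤ (+-mono-≤ (+-mono-≤ h1 h2) h3)
          (+-mono-≤ (≤-reflexive (cong (m *_) (sym (cnt-split Q B)))) (≤-reflexive (sym edges))))
        (id m (E H Q∩B) (E H Q∖B) (E H Q) (cnt Q∩B) (cnt Q∖B) (cnt Q) (cnt cross)))
        where
        id : ∀ m e1 e2 e c1 c2 c x →
          m + (m * c1 + m * c2 + (e + m) + (m * c + (e1 + e2 + x))) + 0 ≡
          x + (e1 + m + (e2 + m) + m * c + (m * (c1 + c2) + (e + 0)))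
        id = solve-∀

-- Greatest sets and partitions into maximal sets.

⇉-antisym : ∀ {n} {A B : Fin n → Bool} → A ⇉ B → B ⇉ A → ∀ v → A v ≡ B v
⇉-antisym {A = A} {B} A⇉B B⇉A v with A v in a | B v in b
... | true  | true  = refl
... | false | false = refl
... | true  | false = bool-contra (A⇉B v a) b
... | false | true  = bool-contra (B⇉A v b) a

bool-stable : ∀ {b} → ¬ ¬ b ≡ true → b ≡ true
bool-stable {true}  _ = refl
bool-stable {false} h = ⊥-elim (h λ ())

⇉-∪ˡ : ∀ {n} {A B : Fin n → Bool} → A ⇉ (A ∪ B)
⇉-∪ˡ v = ∨-trueˡ

⇉-∪ʳ : ∀ {n} {A B : Fin n → Bool} → B ⇉ (A ∪ B)
⇉-∪ʳ {A = A} v = ∨-trueʳ {A v}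

∪-⇉ : ∀ {n} {A B C : Fin n → Bool} → A ⇉ C → B ⇉ C → (A ∪ B) ⇉ C
∪-⇉ {A = A} A⇉C B⇉C v h with ∨-split {A v} h
... | inj₁ v∈A = A⇉C v v∈A
... | inj₂ v∈B = B⇉C v v∈B

-- A member with the smallest complement absorbs every other member, since its union with that
-- member is again a candidate.
greatest : ∀ {n} (P : (Fin n → Bool) → Set) → (∀ A B → P A → P B → P (A ∪ B)) → ∀ A → P A →
           ¬ ¬ ∃ λ C → P C × (∀ B → P B → B ⇉ C)
greatest P closed A pA = do
  C , pC , least ← argmin P (λ X → cnt (not ∘ X)) A pA
  pure (C , pC , λ B pB v v∈B → absorb C B (least (C ∪ B) (closed C B pC pB)) v v∈B)
  where
  absorb : ∀ C B → cnt (not ∘ C) ≤ cnt (not ∘ (C ∪ B)) → B ⇉ C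
  absorb C B le v v∈B with C v in eq
  ... | true  = refl
  ... | false = bool-contra (cnt-reflects-⇉ {p = not ∘ (C ∪ B)} {not ∘ C} (λ w → not-∨ˡ (C w)) le v (cong not eq))
                  (cong not (∨-trueʳ {C v} v∈B))

-- The least element depends only on the values of the predicate, so it is a canonical
-- representative of a class.
first : ∀ {n} → (Fin n → Bool) → Maybe (Fin n)
first {zero}  p = nothing
first {suc n} p = if p zero then just zero else Maybe.map suc (first (p ∘ suc))

first-cong : ∀ {n} {p q : Fin n → Bool} → (∀ i → p i ≡ q i) → first p ≡ first q
first-cong {zero}  h = refl
first-cong {suc n} h = cong₂ (λ b r → if b then just zero else Maybe.map suc r) (h zero) (first-cong (h ∘ suc))

first-sound : ∀ {n} (p : Fin n → Bool) v → p v ≡ true → ∃ λ w → first p ≡ just w × p w ≡ true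
first-sound {suc n} p v pv with p zero in eq
first-sound {suc n} p v       pv | true  = zero , refl , eq
first-sound {suc n} p zero    pv | false = bool-contra pv eq
first-sound {suc n} p (suc v) pv | false with first-sound (p ∘ suc) v pv
... | w , fw , pw = suc w , cong (Maybe.map suc) fw , pw

-- Classes are described by representatives. The field `rep-within` records maximality: no member of
-- `N` spreads over two classes.
record Partition {n} (N : (Fin n → Bool) → Set) : Set where
  field
    rep        : Fin n → Fin n
    rep-class  : ∀ v → ∃ λ C → N C × (∀ w → C w ≡ does (rep w ≟ rep v))
    rep-idem   : ∀ v → rep (rep v) ≡ rep v
    rep-within : ∀ C → N C → ∀ v w → C v ≡ true → C w ≡ true → rep v ≡ rep w

-- The class of `v` is the greatest member of `N` containing `v`. Two such sets that meet coincide,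
-- because their union is again in `N`.
partition : ∀ {n} (N : (Fin n → Bool) → Set) →
  (∀ v → N (λ w → does (v ≟ w))) →
  (∀ A B v → N A → N B → A v ≡ true → B v ≡ true → N (A ∪ B)) →
  ¬ ¬ Partition N
partition {n} N single closed = do
  M ← ¬¬-∀Fin λ v → greatest (λ C → N C × C v ≡ true)
        (λ A B (nA , v∈A) (nB , v∈B) → closed A B v nA nB v∈A v∈B , ∨-trueˡ v∈A)
        (λ w → does (v ≟ w)) (single v , dec-true (v ≟ v) refl)
  pure (fromMaximal (λ v → proj₁ (M v)) (λ v → proj₁ (proj₁ (proj₂ (M v))))
    (λ v → proj₂ (proj₁ (proj₂ (M v)))) (λ v B nB v∈B → proj₂ (proj₂ (M v)) B (nB , v∈B)))
  where
  module _ (M : Fin n → Fin n → Bool) (M∈N : ∀ v → N (M v)) (v∈M : ∀ v → M v v ≡ true)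
           (maximal : ∀ v B → N B → B v ≡ true → B ⇉ M v) where
    same : ∀ v w → M v w ≡ true → ∀ u → M v u ≡ M w u
    same v w w∈Mv = ⇉-antisym Mv⇉Mw (maximal v (M w) (M∈N w) (Mv⇉Mw v (v∈M v)))
      where
      Mv⇉Mw : M v ⇉ M w
      Mv⇉Mw = maximal w (M v) (M∈N v) w∈Mv

    r : ∀ v → ∃ λ w → first (M v) ≡ just w × M v w ≡ true
    r v = first-sound (M v) v (v∈M v)

    rep : Fin n → Fin n
    rep v = proj₁ (r v)

    rep∈M : ∀ v → M v (rep v) ≡ true
    rep∈M v = proj₂ (proj₂ (r v))

    rep-≡ : ∀ v w → M v w ≡ true → rep v ≡ rep w
    rep-≡ v w w∈Mv = just-injective (trans (sym (proj₁ (proj₂ (r v))))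
      (trans (first-cong (same v w w∈Mv)) (proj₁ (proj₂ (r w)))))

    rep-≡⁻¹ : ∀ v w → rep w ≡ rep v → M v w ≡ true
    rep-≡⁻¹ v w eq = trans (same v (rep v) (rep∈M v) w) (trans (cong (λ z → M z w) (sym eq))
      (trans (sym (same w (rep w) (rep∈M w) w)) (v∈M w)))

    class-≡ : ∀ v w → M v w ≡ does (rep w ≟ rep v)
    class-≡ v w with rep w ≟ rep v
    ... | yes eq = rep-≡⁻¹ v w eq
    ... | no neq = ¬true⇒false λ h → neq (sym (rep-≡ v w h))

    fromMaximal : Partition N
    fromMaximal = record
      { rep        = rep
      ; rep-class  = λ v → M v , M∈N v , class-≡ v
      ; rep-idem   = λ v → sym (rep-≡ v (rep v) (rep∈M v))
      ; rep-within = λ C nC v w v∈C w∈C → rep-≡ v w (maximal v C nC v∈C w w∈C)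
      }

-- Splitting a sparse set into `m` forests.

module Colouring {n} (G : Graph n) where
  open Sparsity G

  MinTight : ℕ → ESet → Fin (ne G) → VSet → Set
  MinTight m H f Q = Tight m H Q × ins Q f ≡ true × (∀ A → Tight m H A → ins A f ≡ true → Q ⇉ A)

  -- Tight sets around `f` are closed under intersection, so one of least size is contained in all
  -- of them.
  minTight : ∀ {m H f A} → Sparse m H → Tight m H A → ins A f ≡ true → ¬ ¬ ∃ (MinTight m H f)
  minTight {m} {H} {f} {A} sp tA f∈A = do
    Q , (tQ , f∈Q) , least ← argmin (λ Q → Tight m H Q × ins Q f ≡ true) cnt A (tA , f∈A)
    pure (Q , tQ , f∈Q , λ B tB f∈B v v∈Q → ∧-trueʳ {Q v} (cnt-reflects-⇉ {p = Q ∩ B} {Q} (λ w → ∧-trueˡ {Q w})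
      (least (Q ∩ B) (Tight-∩ sp tQ tB (∧-trueˡ {Q (src f)} f∈Q) (∧-trueˡ {B (src f)} f∈B) , ins-∩ Q B f∈Q f∈B)) v v∈Q))
    where
    ins-∩ : ∀ Q B → ins Q f ≡ true → ins B f ≡ true → ins (Q ∩ B) f ≡ true
    ins-∩ Q B q b = ∧-true (∧-true (∧-trueˡ {Q (src f)} q) (∧-trueˡ {B (src f)} b))
                           (∧-true (∧-trueʳ {Q (src f)} q) (∧-trueʳ {B (src f)} b))

  Colours : ℕ → Set
  Colours m = Fin (ne G) → Fin m

  class : ∀ {m} → ESet → Colours m → Fin m → ESet
  class H c i e = H e ∧ does (c e ≟ i)

  _[_↦_] : ∀ {m} → Colours m → Fin (ne G) → Fin m → Colours m
  (c [ g ↦ i ]) e = if does (g ≟ e) then i else c e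

  ∑-class : ∀ {m} H (c : Colours m) (q : ESet) →
            ∑ (λ i → cnt λ e → class H c i e ∧ q e) ≡ cnt (λ e → H e ∧ q e)
  ∑-class {m} H c q = begin
    ∑ (λ i → cnt λ e → class H c i e ∧ q e)                  ≡⟨ ∑-cong (λ i → cnt-∑ _) ⟩
    ∑ (λ i → ∑ λ e → ι (class H c i e ∧ q e))                ≡⟨ ∑-swap (λ i e → ι (class H c i e ∧ q e)) ⟩
    ∑ (λ e → ∑ λ i → ι (class H c i e ∧ q e))                ≡⟨ ∑-cong inner ⟩
    ∑ (λ e → ι (H e ∧ q e))                                  ≡⟨ cnt-∑ _ ⟨
    cnt (λ e → H e ∧ q e)                                    ∎
    where
    open ≡-Reasoning
    bool : ∀ h d q → (h ∧ d) ∧ q ≡ d ∧ (h ∧ q)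
    bool = toWitness {a? = ∀Bool? λ h → ∀Bool? λ d → ∀Bool? λ q → (h ∧ d) ∧ q Data.Bool.≟ _} _
    inner : ∀ e → ∑ (λ i → ι (class H c i e ∧ q e)) ≡ ι (H e ∧ q e)
    inner e = trans (sym (cnt-∑ _)) (trans (cnt-cong λ i → bool (H e) (does (c e ≟ i)) (q e))
      (cnt-singleton (c e) (λ _ → H e ∧ q e)))

  ∑-E-class : ∀ {m} H (c : Colours m) A → ∑ (λ i → E (class H c i) A) ≡ E H A
  ∑-E-class H c A = trans (∑-cong λ i → E-def (class H c i) A) (trans (∑-class H c (ins A)) (sym (E-def H A)))

  -- The augmentation step of matroid partition for forests, which are the sets that are `Sparse 1`:
  -- all edges but `f₀` are coloured, and the absence of a complete colouring is refuted.
  module Augment {m} (H : ESet) (spH : Sparse m H) (f₀ : Fin (ne G)) (f₀∈H : H f₀ ≡ true)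
    (c₀ : Colours m) (sp₀ : ∀ i → Sparse 1 (class (remove f₀ H) c₀ i))
    (stuck : ¬ ∃ λ c → ∀ (i : Fin m) → Sparse 1 (class H c i)) where

    -- A state (c , g) is a colouring of H with the edge g left uncoloured.
    K : Colours m → Fin (ne G) → Fin m → ESet
    K c g i = class (remove g H) c i

    -- In an exchange `g` receives colour `i` and `g′` becomes uncoloured. The condition on tight
    -- sets says that `g′` lies on the cycle that `g` would close, if there is one, so the class
    -- remains a forest.
    data Reachable : Colours m → Fin (ne G) → Set where
      start    : Reachable c₀ f₀
      exchange : ∀ {c g i g′} → Reachable c g → K c g i g′ ≡ true →
                 (∀ A → Tight 1 (K c g i) A → ins A g ≡ true → ins A g′ ≡ true) →
                 Reachable (c [ g ↦ i ]) g′

    K-self : ∀ c g i → K c g i g ≡ false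
    K-self c g i rewrite dec-true (g ≟ g) refl with H g
    ... | true  = refl
    ... | false = refl

    K⇉H : ∀ c g i → K c g i ⇉ H
    K⇉H c g i e h = ∧-trueˡ {H e} (∧-trueˡ {remove g H e} h)

    insert-K-same : ∀ {c g i} → H g ≡ true → ∀ e → insert g (K c g i) e ≡ class H (c [ g ↦ i ]) i e
    insert-K-same {c} {g} {i} g∈H e with g ≟ e
    ... | yes refl rewrite g∈H | dec-true (i ≟ i) refl = refl
    ... | no _ with H e | does (c e ≟ i)
    ...   | true  | true  = refl
    ...   | true  | false = refl
    ...   | false | _     = refl

    K-other : ∀ {c g i j} → i ≢ j → ∀ e → K c g j e ≡ class H (c [ g ↦ i ]) j e
    K-other {c} {g} {i} {j} i≢j e with g ≟ e
    ... | yes refl rewrite dec-false (i ≟ j) i≢j with H e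
    ...   | true  = refl
    ...   | false = refl
    K-other {c} {g} {i} {j} i≢j e | no _ with H e
    ...   | true  = refl
    ...   | false = refl

    exchange-same : ∀ {c g i g′} → H g ≡ true → K c g i g′ ≡ true →
                    ∀ e → swap g g′ (K c g i) e ≡ K (c [ g ↦ i ]) g′ i e
    exchange-same {c} {g} {i} {g′} g∈H g′∈K e with g ≟ e
    ... | yes refl rewrite g∈H | dec-true (i ≟ i) refl
                         | dec-false (g′ ≟ g) (λ { refl → bool-contra g′∈K (K-self c g i) }) = refl
    ... | no _ with H e | does (c e ≟ i) | does (g′ ≟ e)
    ...   | true  | true  | true  = refl
    ...   | true  | true  | false = refl
    ...   | true  | false | true  = refl
    ...   | true  | false | false = refl
    ...   | false | _     | _     = refl

    exchange-other : ∀ {c g i j g′} → i ≢ j → K c g i g′ ≡ true →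
                     ∀ e → K c g j e ≡ K (c [ g ↦ i ]) g′ j e
    exchange-other {c} {g} {i} {j} {g′} i≢j g′∈K e with g ≟ e
    ... | yes refl rewrite dec-false (i ≟ j) i≢j with H e | does (g′ ≟ e)
    ...   | true  | true  = refl
    ...   | true  | false = refl
    ...   | false | _     = refl
    exchange-other {c} {g} {i} {j} {g′} i≢j g′∈K e | no _ with g′ ≟ e
    ... | no _ with H e
    ...   | true  = refl
    ...   | false = refl
    exchange-other {c} {g} {i} {j} {g′} i≢j g′∈K e | no _ | yes refl
      rewrite does-true (c e ≟ i) (∧-trueʳ {remove g H e} g′∈K) | dec-false (i ≟ j) i≢j with H e
    ...   | true  = refl
    ...   | false = refl

    invariant : ∀ {c g} → Reachable c g → H g ≡ true × (∀ i → Sparse 1 (K c g i))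
    invariant start = f₀∈H , sp₀
    invariant (exchange {c} {g} {i} {g′} r g′∈K tight∋g′) = K⇉H c g i g′ g′∈K , sparse
      where
      g∈H = proj₁ (invariant r)
      sp  = proj₂ (invariant r)
      sparse : ∀ j → Sparse 1 (K (c [ g ↦ i ]) g′ j)
      sparse j with i ≟ j
      ... | yes refl = Sparse-cong (exchange-same {c} {g} g∈H g′∈K) (Sparse-swap (K-self c g i) g′∈K (sp i) tight∋g′)
      ... | no i≢j   = Sparse-cong (exchange-other {c} {g} i≢j g′∈K) (sp j)

    tight-around : ∀ {c g} → Reachable c g → ∀ i → ¬ ¬ ∃ (MinTight 1 (K c g i) g)
    tight-around {c} {g} r i = do
      yes (A , tA , g∈A) ← em (∃ λ A → Tight 1 (K c g i) A × ins A g ≡ true)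
        where no ¬tight → λ _ → stuck (c [ g ↦ i ] , λ j → recolour j λ A tA g∈A → ¬tight (A , tA , g∈A))
      minTight (sp i) tA g∈A
      where
      g∈H = proj₁ (invariant r)
      sp  = proj₂ (invariant r)
      recolour : ∀ j → (∀ A → Tight 1 (K c g i) A → ¬ ins A g ≡ true) → Sparse 1 (class H (c [ g ↦ i ]) j)
      recolour j ¬tight with i ≟ j
      ... | yes refl = Sparse-cong (insert-K-same {c} {g} g∈H) (Sparse-insert (sp i) (K-self c g i) ¬tight)
      ... | no i≢j   = Sparse-cong (K-other {c} {g} i≢j) (sp j)

    -- The union U of all minimal tight sets around uncoloured edges is tight in every colour class, hence spans too many
    -- edges of H.
    InU : Fin n → Set
    InU v = ∃ λ c → ∃ λ g → ∃ λ i → ∃ λ Q → Reachable c g × MinTight 1 (K c g i) g Q × Q v ≡ true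

    module _ (U : VSet) (U-sound : ∀ v → U v ≡ true → InU v) (U-complete : ∀ v → InU v → U v ≡ true) where
      Q⇉U : ∀ {c g i Q} → Reachable c g → MinTight 1 (K c g i) g Q → Q ⇉ U
      Q⇉U r mt v v∈Q = U-complete v (_ , _ , _ , _ , r , mt , v∈Q)

      -- Undoing an exchange changes tightness only across g and g′, which lie in a common tight subset of U.
      pull-back : ∀ {c g} → Reachable c g → ∀ i A → Tight 1 (K c g i) A → A ⇉ U →
                  ¬ ¬ ∃ λ A′ → A ⇉ A′ × Tight 1 (K c₀ f₀ i) A′ × A′ ⇉ U
      pull-back start i A tA A⇉U = pure (A , (λ _ h → h) , tA , A⇉U)
      pull-back r′@(exchange {c} {g} {j} {g′} r g′∈K tight∋g′) i A tA A⇉U with j ≟ i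
      ... | no j≢i = pull-back r i A (Tight-cong {A = A} (λ e → sym (exchange-other {c} {g} j≢i g′∈K e)) (λ _ → refl) tA) A⇉U
      ... | yes refl with ins A g in g∈A
      -- With `g` not inside `A`, undoing the exchange can only add edges inside `A`.
      ...   | false = pull-back r i A (≤-trans tA (+-monoˡ-≤ 1 fewer)) A⇉U
        where
        fewer : E (K (c [ g ↦ i ]) g′ i) A ≤ E (K c g i) A
        fewer = begin
          E (K (c [ g ↦ i ]) g′ i) A                        ≡⟨ E-cong {A = A} (exchange-same {c} {g} (proj₁ (invariant r)) g′∈K) (λ _ → refl) ⟨
          E (swap g g′ (K c g i)) A                         ≤⟨ m≤m+n _ _ ⟩
          E (swap g g′ (K c g i)) A + ι (ins A g′)          ≡⟨ E-swap (K-self c g i) g′∈K A ⟩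
          E (K c g i) A + ι (ins A g)                       ≡⟨ cong (λ b → E (K c g i) A + ι b) g∈A ⟩
          E (K c g i) A + 0                                 ≡⟨ +-identityʳ _ ⟩
          E (K c g i) A                                     ∎
          where open ≤-Reasoning
      ...   | true = do
        -- The set `Q` contains both `g` and `g′`, so the exchange leaves the edge counts of `Q` and
        -- `A ∪ Q` unchanged.
        Q , mt@(tQ , g∈Q , _) ← tight-around r i
        A′ , A∪Q⇉A′ , tA′ , A′⇉U ← pull-back r i (A ∪ Q)
          (subst (λ z → 1 * cnt (A ∪ Q) ≤ z + 1) (same (A ∪ Q) (ins-mono {Q} (⇉-∪ʳ {A = A}) g g∈Q) (ins-mono {Q} (⇉-∪ʳ {A = A}) g′ (tight∋g′ Q tQ g∈Q)))
            (Tight-∪ {A = A} {Q} (proj₂ (invariant r′) i) tA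
              (subst (λ z → 1 * cnt Q ≤ z + 1) (sym (same Q g∈Q (tight∋g′ Q tQ g∈Q))) tQ)
              (∧-trueˡ {A (src g)} g∈A) (∧-trueˡ {Q (src g)} g∈Q)))
          (∪-⇉ {A = A} A⇉U (Q⇉U r mt))
        pure (A′ , (λ v v∈A → A∪Q⇉A′ v (∨-trueˡ v∈A)) , tA′ , A′⇉U)
        where
        same : ∀ B → ins B g ≡ true → ins B g′ ≡ true → E (K (c [ g ↦ i ]) g′ i) B ≡ E (K c g i) B
        same B g∈B g′∈B = +-cancelʳ-≡ 1 _ _ (begin
          E (K (c [ g ↦ i ]) g′ i) B + 1                   ≡⟨ cong (_+ 1) (E-cong {A = B} (exchange-same {c} {g} (proj₁ (invariant r)) g′∈K) (λ _ → refl)) ⟨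
          E (swap g g′ (K c g i)) B + 1                    ≡⟨ cong (λ b → E (swap g g′ (K c g i)) B + ι b) g′∈B ⟨
          E (swap g g′ (K c g i)) B + ι (ins B g′)         ≡⟨ E-swap (K-self c g i) g′∈K B ⟩
          E (K c g i) B + ι (ins B g)                      ≡⟨ cong (λ b → E (K c g i) B + ι b) g∈B ⟩
          E (K c g i) B + 1                                ∎)
          where open ≡-Reasoning

      -- Take the greatest set `B` inside `U` that surrounds `f₀` and is tight in the initial class
      -- `i`. All minimal tight sets of all reachable states turn out to lie in `B`, hence `B` is
      -- `U`.
      U-tight : ∀ i → ¬ ¬ (Tight 1 (K c₀ f₀ i) U × ins U f₀ ≡ true)
      U-tight i = do
        Q , mt@(tQ , f₀∈Q , _) ← tight-around start i
        B , (tB , B⇉U , f₀∈B) , max ← greatest P closed Q (tQ , Q⇉U start mt , f₀∈Q)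
        pure (Tight-cong {A = B} {U} (λ _ → refl) (⇉-antisym B⇉U (U⇉B B tB B⇉U f₀∈B max)) tB , ins-mono {B} B⇉U f₀ f₀∈B)
        where
        P : VSet → Set
        P B = Tight 1 (K c₀ f₀ i) B × B ⇉ U × ins B f₀ ≡ true

        closed : ∀ A B → P A → P B → P (A ∪ B)
        closed A B (tA , A⇉U , f₀∈A) (tB , B⇉U , f₀∈B) =
          Tight-∪ {A = A} {B} (sp₀ i) tA tB (∧-trueˡ {A (src f₀)} f₀∈A) (∧-trueˡ {B (src f₀)} f₀∈B) ,
          ∪-⇉ {A = A} A⇉U B⇉U , ins-mono {A} (⇉-∪ˡ {A = A} {B}) f₀ f₀∈A

        module _ (B : VSet) (tB : Tight 1 (K c₀ f₀ i) B) (B⇉U : B ⇉ U) (f₀∈B : ins B f₀ ≡ true)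
                 (max : ∀ A → P A → A ⇉ B) where
          absorb : ∀ A v → Tight 1 (K c₀ f₀ i) A → A ⇉ U → A v ≡ true → B v ≡ true → A ⇉ B
          absorb A v tA A⇉U v∈A v∈B w w∈A = max (A ∪ B)
            (Tight-∪ {A = A} {B} (sp₀ i) tA tB v∈A v∈B , ∪-⇉ {A = A} A⇉U B⇉U , ins-mono {B} (⇉-∪ʳ {A = A}) f₀ f₀∈B)
            w (∨-trueˡ w∈A)

          -- Otherwise an edge `e` of class `j` inside `Q` crosses the border of `B`, and it can be
          -- exchanged with `g`. The tight set of colour `i` around `e` pulls back to an initial
          -- tight set inside `U` that meets `B`, so maximality puts both ends of `e` into `B`.
          fill : ∀ {c g j Q} → Reachable c g → MinTight 1 (K c g j) g Q → ins B g ≡ true → Q ⇉ B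
          fill {c} {g} {j} {Q} r (tQ , g∈Q , min) g∈B v v∈Q with B v in v∉B
          ... | true = refl
          ... | false with crossing-edge {B = B} (proj₂ (invariant r) j) tQ
                             (∧-trueˡ {Q (src g)} g∈Q) (∧-trueˡ {B (src g)} g∈B) v∈Q v∉B
          ...   | e , e∈K , e∈Q , crosses = bool-stable λ _ → contra λ ()
            where
            r′ : Reachable (c [ g ↦ j ]) e
            r′ = exchange r e∈K λ A tA g∈A → ins-mono {Q} (min A tA g∈A) e e∈Q
            ends-together : ∀ A → Tight 1 (K c₀ f₀ i) A → A ⇉ U → ins A e ≡ true → ⊥
            ends-together A tA A⇉U e∈A with B (src e) in s∈B | B (tgt e) in t∈B
            ... | true  | false = bool-contra (absorb A (src e) tA A⇉U (∧-trueˡ {A (src e)} e∈A) s∈B (tgt e) (∧-trueʳ {A (src e)} e∈A)) t∈B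
            ... | false | true  = bool-contra (absorb A (tgt e) tA A⇉U (∧-trueʳ {A (src e)} e∈A) t∈B (src e) (∧-trueˡ {A (src e)} e∈A)) s∈B
            ends-together A tA A⇉U e∈A | true  | true  = bool-contra crosses refl
            ends-together A tA A⇉U e∈A | false | false = bool-contra crosses refl
            contra : ¬ ¬ ⊥
            contra = do
              Q′ , mt′@(tQ′ , e∈Q′ , _) ← tight-around r′ i
              A , Q′⇉A , tA , A⇉U ← pull-back r′ i Q′ tQ′ (Q⇉U r′ mt′)
              pure (ends-together A tA A⇉U (ins-mono {Q′} Q′⇉A e e∈Q′))

          inside : ∀ {c g} → Reachable c g → ins B g ≡ true
          inside start = f₀∈B
          inside (exchange {c} {g} {j} {g′} r _ tight∋g′) = bool-stable do
            Q , mt@(tQ , g∈Q , _) ← tight-around r j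
            pure (ins-mono {Q} (fill r mt (inside r)) g′ (tight∋g′ Q tQ g∈Q))

          U⇉B : U ⇉ B
          U⇉B v v∈U with U-sound v v∈U
          ... | _ , _ , _ , _ , r , mt , v∈Q = fill r mt (inside r) v v∈Q

      -- Summing tightness over the `m` colours shows that the edges inside `U` other than `f₀`
      -- already exhaust the sparsity bound.
      overfull : (∀ i → Tight 1 (K c₀ f₀ i) U) → ins U f₀ ≡ true → ⊥
      overfull tight f₀∈U = <⇒≱ more-edges (begin
        E H U + m                                           ≤⟨ spH U (src f₀) (∧-trueˡ {U (src f₀)} f₀∈U) ⟩
        m * cnt U                                           ≡⟨ ∑-const m (cnt U) ⟨
        ∑ {m} (λ _ → cnt U)                                 ≡⟨ ∑-cong {m} (λ _ → sym (*-identityˡ (cnt U))) ⟩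
        ∑ {m} (λ _ → 1 * cnt U)                             ≤⟨ ∑-mono tight ⟩
        ∑ {m} (λ i → E (K c₀ f₀ i) U + 1)                   ≡⟨ ∑-+ _ _ ⟩
        ∑ {m} (λ i → E (K c₀ f₀ i) U) + ∑ {m} (λ _ → 1)     ≡⟨ cong₂ _+_ (∑-E-class (remove f₀ H) c₀ U) (∑-const m 1) ⟩
        E (remove f₀ H) U + m * 1                           ≡⟨ cong (_ +_) (*-identityʳ m) ⟩
        E (remove f₀ H) U + m                               ∎)
        where
        open ≤-Reasoning
        more-edges : E (remove f₀ H) U + m < E H U + m
        more-edges = +-monoˡ-< m (≤-reflexive (trans (+-comm 1 _) (trans
          (cong (λ b → E (remove f₀ H) U + ι b) (sym f₀∈U)) (E-remove H U f₀∈H))))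

    impossible : .{{NonZero m}} → ⊥
    impossible = contra λ ()
      where
      contra : ¬ ¬ ⊥
      contra = do
        -- Membership in `U` quantifies over all reachable states; its Boolean form is available
        -- under double negation.
        inU? ← ¬¬-∀Fin λ v → em (InU v)
        ts ← ¬¬-∀Fin (U-tight (fromDec inU?) (λ v → does-true (inU? v)) (λ v → dec-true (inU? v)))
        pure (overfull _ (λ v → does-true (inU? v)) (λ v → dec-true (inU? v)) (λ i → proj₁ (ts i)) (f₀∈U ts))
        where
        f₀∈U : ∀ {U} → (∀ (i : Fin m) → Tight 1 (K c₀ f₀ i) U × ins U f₀ ≡ true) → ins U f₀ ≡ true
        f₀∈U ts = proj₂ (ts (fromℕ< (ℕ.>-nonZero⁻¹ m)))

  -- Induction on the number of edges: all edges but one are coloured first, and then the colouring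
  -- is augmented.
  decompose : ∀ {m} → .{{NonZero m}} → ∀ H → Sparse m H → ¬ ¬ ∃ λ c → ∀ (i : Fin m) → Sparse 1 (class H c i)
  decompose {m} H = go (suc (cnt H)) H ≤-refl
    where
    go : ∀ N H → cnt H < N → Sparse m H → ¬ ¬ ∃ λ c → ∀ (i : Fin m) → Sparse 1 (class H c i)
    go (suc N) H (s≤s cnt≤N) sp with Fin.any? (λ e → H e Data.Bool.≟ true)
    ... | no ¬e = pure ((λ _ → fromℕ< (ℕ.>-nonZero⁻¹ m)) , λ i →
            Sparse-cong (λ e → sym (cong (_∧ _) (¬true⇒false λ h → ¬e (e , h)))) Sparse-∅)
    ... | yes (f₀ , f₀∈H) = do
      c₀ , sp₀ ← go N (remove f₀ H) fewer (Sparse-mono (λ e → ∧-trueˡ {H e}) sp)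
      yes found ← em (∃ λ c → ∀ (i : Fin m) → Sparse 1 (class H c i))
        where no stuck → λ _ → Augment.impossible H sp f₀ f₀∈H c₀ sp₀ stuck
      pure found
      where
      fewer : cnt (remove f₀ H) < N
      fewer = ≤-trans (≤-reflexive (trans (+-comm 1 _) (trans (cong (_+ 1) (cnt-cong λ e → sym (∧-identityʳ _)))
                (trans (cnt-remove H (λ _ → true) f₀∈H) (cnt-cong λ e → ∧-identityʳ _))))) cnt≤N

-- Degrees and exchanges inside tight sets.

module Degrees {n} (G : Graph n) where
  open Sparsity G

  inc : Fin n → ESet
  inc v e = does (src e ≟ v) ∨ does (tgt e ≟ v)

  opaque
    dg : ESet → Fin n → ℕ
    dg H v = cnt λ e → H e ∧ inc v e

  opaque
    unfolding dg

    dg-def : ∀ H v → dg H v ≡ cnt (λ e → H e ∧ inc v e)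
    dg-def H v = refl

    dg-swap : ∀ {H f e} → H f ≡ false → H e ≡ true →
              ∀ v → dg (swap f e H) v + ι (inc v e) ≡ dg H v + ι (inc v f)
    dg-swap f∉H e∈H v = cnt-swap f∉H e∈H (inc v)

    dg-cong : ∀ {H K} v → (∀ e → inc v e ≡ true → H e ≡ K e) → dg H v ≡ dg K v
    dg-cong {H} {K} v h = cnt-cong λ e → ∧-cong-on (inc v e) (h e)

    dg-mono : ∀ {H K} v → H ⇉ K → dg H v ≤ dg K v
    dg-mono {H} v h = cnt-mono λ e t → ∧-true (h e (∧-trueˡ {H e} t)) (∧-trueʳ {H e} t)

  opaque
    unfolding E

    E-inside : ∀ {H K} C → (∀ e → ins C e ≡ true → H e ≡ K e) → E H C ≡ E K C
    E-inside {H} {K} C h = cnt-cong λ e → ∧-cong-on (ins C e) (h e)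

    cnt-inside : ∀ H C → cnt H ≡ E H C + cnt (λ e → H e ∧ not (ins C e))
    cnt-inside H C = cnt-split H (ins C)

    E-all : ∀ H → E H (λ _ → true) ≡ cnt H
    E-all H = cnt-cong λ e → ∧-identityʳ (H e)

  rest-cong : ∀ {H K : ESet} C → (∀ e → ins C e ≡ false → H e ≡ K e) →
              cnt (λ e → H e ∧ not (ins C e)) ≡ cnt (λ e → K e ∧ not (ins C e))
  rest-cong {H} {K} C h = cnt-cong λ e → off (ins C e) (h e)
    where
    off : ∀ {a b} c → (c ≡ false → a ≡ b) → a ∧ not c ≡ b ∧ not c
    off         false h = cong (_∧ true) (h refl)
    off {a} {b} true  h = trans (∧-zeroʳ a) (sym (∧-zeroʳ b))

  E-outside : ∀ {H K} C → cnt H ≡ cnt K → (∀ e → ins C e ≡ false → H e ≡ K e) → E H C ≡ E K C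
  E-outside {H} {K} C size h = +-cancelʳ-≡ _ _ _ (begin
    E H C + cnt (λ e → H e ∧ not (ins C e))   ≡⟨ cnt-inside H C ⟨
    cnt H                                     ≡⟨ size ⟩
    cnt K                                     ≡⟨ cnt-inside K C ⟩
    E K C + cnt (λ e → K e ∧ not (ins C e))   ≡⟨ cong (E K C +_) (rest-cong {H} {K} C h) ⟨
    E K C + cnt (λ e → H e ∧ not (ins C e))   ∎)
    where open ≡-Reasoning

  cnt-≡ : ∀ {H K} C → E H C ≡ E K C → (∀ e → ins C e ≡ false → H e ≡ K e) → cnt H ≡ cnt K
  cnt-≡ {H} {K} C inside h =
    trans (cnt-inside H C) (trans (cong₂ _+_ inside (rest-cong {H} {K} C h)) (sym (cnt-inside K C)))

  outside-of : ∀ {C : VSet} v e → inc v e ≡ true → C v ≡ false → ins C e ≡ false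
  outside-of {C} v e ve v∉C with src e ≟ v
  ... | yes refl = cong (_∧ C (tgt e)) v∉C
  ... | no _ with tgt e ≟ v
  ...   | yes refl = trans (cong (C (src e) ∧_) v∉C) (∧-zeroʳ _)

  disjoint-ins : ∀ {C D : VSet} → (∀ v → C v ≡ true → D v ≡ false) → ∀ e → ins C e ≡ true → ins D e ≡ false
  disjoint-ins {C} {D} dis e e∈C = cong (_∧ D (tgt e)) (dis (src e) (∧-trueˡ {C (src e)} e∈C))

  ins-mono-false : ∀ {C D : VSet} → C ⇉ D → ∀ e → ins D e ≡ false → ins C e ≡ false
  ins-mono-false {C} C⇉D e e∉D = ¬true⇒false λ e∈C → bool-contra (ins-mono {C} C⇉D e e∈C) e∉D

  module Exchange (m : ℕ) .{{_ : NonZero m}} (η : Fin n → ℕ) (H : ESet) (spH : Sparse m H) where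

    -- An edge with at most one end in `C` counts as outside, so the degrees of vertices outside `C`
    -- do not change.
    record Reduced (C : VSet) (w : Fin n) (H′ : ESet) : Set where
      field
        sparse  : Sparse m H′
        size    : cnt H′ ≡ cnt H
        outside : ∀ e → ins C e ≡ false → H′ e ≡ H e
        drop    : dg H′ w < η w
        bounded : ∀ v → C v ≡ true → dg H′ v ≤ η v

    record Nice (C : VSet) : Set where
      field
        tight     : Tight m H C
        bounded   : ∀ v → C v ≡ true → dg H v ≤ η v
        reducible : ∀ w → C w ≡ true → ∃ (Reduced C w)

    Reduced-⇉ : ∀ {C D w H′} → C ⇉ D → (∀ v → D v ≡ true → dg H v ≤ η v) → Reduced C w H′ → Reduced D w H′
    Reduced-⇉ {C} {D} {w} {H′} C⇉D bnd red = record
      { sparse  = R.sparse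
      ; size    = R.size
      ; outside = λ e e∉D → R.outside e (ins-mono-false {C} C⇉D e e∉D)
      ; drop    = R.drop
      ; bounded = bounded
      }
      where
      module R = Reduced red
      bounded : ∀ v → D v ≡ true → dg H′ v ≤ η v
      bounded v v∈D with C v in v?C
      ... | true  = R.bounded v v?C
      ... | false = subst (_≤ η v) (sym (dg-cong v λ e ve → R.outside e (outside-of {C} v e ve v?C))) (bnd v v∈D)

    -- A reduction inside one of the two sets is also a reduction inside the union, since it changes
    -- no degree outside the smaller set.
    Nice-∪ : ∀ {A B v} → Nice A → Nice B → A v ≡ true → B v ≡ true → Nice (A ∪ B)
    Nice-∪ {A} {B} {v} a b v∈A v∈B = record
      { tight     = Tight-∪ {A = A} {B} spH A.tight B.tight v∈A v∈B
      ; bounded   = bnd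
      ; reducible = red
      }
      where
      module A = Nice a
      module B = Nice b
      bnd : ∀ w → (A ∪ B) w ≡ true → dg H w ≤ η w
      bnd w w∈ with ∨-split {A w} w∈
      ... | inj₁ w∈A = A.bounded w w∈A
      ... | inj₂ w∈B = B.bounded w w∈B
      red : ∀ w → (A ∪ B) w ≡ true → ∃ (Reduced (A ∪ B) w)
      red w w∈ with ∨-split {A w} w∈
      ... | inj₁ w∈A = let H′ , r = A.reducible w w∈A in H′ , Reduced-⇉ (⇉-∪ˡ {A = A} {B}) bnd r
      ... | inj₂ w∈B = let H′ , r = B.reducible w w∈B in H′ , Reduced-⇉ (⇉-∪ʳ {A = A} {B}) bnd r

    -- The drop at `w` is measured against `H`, because `w` may still exceed its bound. The last
    -- field prevents the excess from growing at any vertex.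
    record Switched (D : VSet) (w : Fin n) (H′ : ESet) : Set where
      field
        sparse  : Sparse m H′
        size    : cnt H′ ≡ cnt H
        outside : ∀ e → ins D e ≡ false → H′ e ≡ H e
        drop    : dg H′ w < dg H w
        bounded : ∀ v → dg H′ v ≤ η v ⊎ dg H′ v ≤ dg H v

    -- First lower the degrees of both ends of f inside the disjoint sets A and B, then swap f for an edge at w.
    module Switch {A B Q : VSet} (nA : Nice A) (nB : Nice B) (disjoint : ∀ v → A v ≡ true → B v ≡ false)
      (f : Fin (ne G)) (f∉H : H f ≡ false) (s∈A : A (src f) ≡ true) (t∈B : B (tgt f) ≡ true)
      (tQ : Tight m H Q) (f∈Q : ins Q f ≡ true) (minQ : ∀ C → Tight m H C → ins C f ≡ true → Q ⇉ C)
      (w : Fin n) (w∈Q : Q w ≡ true) (w∉A : A w ≡ false) (w∉B : B w ≡ false) where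
      private
        module NA = Nice nA
        module NB = Nice nB

      disjoint′ : ∀ v → B v ≡ true → A v ≡ false
      disjoint′ v v∈B = ¬true⇒false λ v∈A → bool-contra v∈B (disjoint v v∈A)

      HA HB H₂ : ESet
      -- The source of `f` is lowered inside `A` and its target inside `B`; disjointness makes the
      -- two changes independent.
      HA = proj₁ (NA.reducible (src f) s∈A)
      HB = proj₁ (NB.reducible (tgt f) t∈B)
      H₂ = splice B HB HA

      private
        module RA = Reduced (proj₂ (NA.reducible (src f) s∈A))
        module RB = Reduced (proj₂ (NB.reducible (tgt f) t∈B))

      H₂-inside : ∀ e → ins B e ≡ true → H₂ e ≡ HB e
      H₂-inside e e∈B = cong (λ b → if b then HB e else HA e) e∈B

      H₂-HA : ∀ e → ins B e ≡ false → H₂ e ≡ HA e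
      H₂-HA e e∉B = cong (λ b → if b then HB e else HA e) e∉B

      H₂-outside : ∀ e → ins A e ≡ false → ins B e ≡ false → H₂ e ≡ H e
      H₂-outside e e∉A e∉B = trans (H₂-HA e e∉B) (RA.outside e e∉A)

      H₂-HB : ∀ e → ins A e ≡ false → H₂ e ≡ HB e
      H₂-HB e e∉A with ins B e in eq
      ... | true  = refl
      ... | false = trans (RA.outside e e∉A) (sym (RB.outside e eq))

      E-HA-B : E HA B ≡ E H B
      E-HA-B = E-inside B λ e e∈B → RA.outside e (disjoint-ins {B} {A} disjoint′ e e∈B)

      E-H₂-B : E H₂ B ≡ E H B
      E-H₂-B = trans (E-inside B H₂-inside) (E-outside B RB.size RB.outside)

      E-H₂-A : E H₂ A ≡ E H A
      E-H₂-A = trans (E-inside A λ e e∈A → H₂-HA e (disjoint-ins {A} {B} disjoint e e∈A)) (E-outside A RA.size RA.outside)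

      -- By disjointness `HA` agrees with `H` inside `B`, so `B` is tight for `HA` and may be
      -- refilled from `HB`.
      sparse₂ : Sparse m H₂
      sparse₂ = Sparse-splice {C = B} RA.sparse RB.sparse (subst (λ z → m * cnt B ≤ z + m) (sym E-HA-B) NB.tight)

      size₂ : cnt H₂ ≡ cnt H
      size₂ = trans (cnt-≡ B (trans E-H₂-B (sym E-HA-B)) H₂-HA) RA.size

      tight-A : Tight m H₂ A
      tight-A = subst (λ z → m * cnt A ≤ z + m) (sym E-H₂-A) NA.tight

      tight-B : Tight m H₂ B
      tight-B = subst (λ z → m * cnt B ≤ z + m) (sym E-H₂-B) NB.tight

      E-superset : ∀ C → A ⇉ C → B ⇉ C → E H₂ C ≡ E H C
      E-superset C A⇉C B⇉C = E-outside C size₂ λ e e∉C →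
        H₂-outside e (ins-mono-false {A} A⇉C e e∉C) (ins-mono-false {B} B⇉C e e∉C)

      private
        at-w : VSet
        at-w v = does (w ≟ v)
        w≢s : at-w (src f) ≡ false
        w≢s = dec-false (w ≟ src f) λ { refl → bool-contra s∈A w∉A }
        -- Separating `w` from the rest of the tight set `Q` yields an edge of `H` at `w` inside
        -- `Q`.
        found = crossing-edge {Q = Q} {B = at-w} spH tQ w∈Q (dec-true (w ≟ w) refl) (∧-trueˡ {Q (src f)} f∈Q) w≢s

      e : Fin (ne G)
      e = proj₁ found

      e∈H : H e ≡ true
      e∈H = proj₁ (proj₂ found)

      e∈Q : ins Q e ≡ true
      e∈Q = proj₁ (proj₂ (proj₂ found))

      w∈e : inc w e ≡ true
      w∈e with w ≟ src e | w ≟ tgt e | proj₂ (proj₂ (proj₂ found))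
      ... | yes p | _     | _ = ∨-trueˡ (dec-true (src e ≟ w) (sym p))
      ... | no _  | yes p | _ = ∨-trueʳ {does (src e ≟ w)} (dec-true (tgt e ≟ w) (sym p))

      e∉A : ins A e ≡ false
      e∉A = outside-of {A} w e w∈e w∉A

      e∉B : ins B e ≡ false
      e∉B = outside-of {B} w e w∈e w∉B

      e∈H₂ : H₂ e ≡ true
      e∈H₂ = trans (H₂-outside e e∉A e∉B) e∈H

      f∉H₂ : H₂ f ≡ false
      f∉H₂ = trans (H₂-outside f (trans (cong (A (src f) ∧_) (disjoint′ _ t∈B)) (∧-zeroʳ (A (src f)))) (cong (_∧ B (tgt f)) (disjoint _ s∈A))) f∉H

      -- Enlarging `C` by `A` and `B` gives a set on which `H₂` and `H` have equally many edges. So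
      -- it is tight for `H` and contains `Q`, hence `e`. As `e` lies inside neither `A` nor `B`,
      -- `edge-in-∪` returns it to `C`.
      tight∋e : ∀ C → Tight m H₂ C → ins C f ≡ true → ins C e ≡ true
      tight∋e C tC f∈C = in-C (in-CA (ins-mono {Q} (minQ C∪A∪B tight-H f∈C∪A∪B) e e∈Q))
        where
        s∈C = ∧-trueˡ {C (src f)} f∈C
        t∈C = ∧-trueʳ {C (src f)} f∈C
        C∪A C∪A∪B : VSet
        C∪A   = C ∪ A
        C∪A∪B = C∪A ∪ B
        tCA : Tight m H₂ C∪A
        tCA = Tight-∪ {A = C} {A} sparse₂ tC tight-A s∈C s∈A
        t∈CA : C∪A (tgt f) ≡ true
        t∈CA = ∨-trueˡ t∈C
        tight-H : Tight m H C∪A∪B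
        tight-H = subst (λ z → m * cnt C∪A∪B ≤ z + m)
          (E-superset C∪A∪B (λ v v∈A → ∨-trueˡ (∨-trueʳ {C v} v∈A)) (⇉-∪ʳ {A = C∪A}))
          (Tight-∪ {A = C∪A} {B} sparse₂ tCA tight-B t∈CA t∈B)
        f∈C∪A∪B : ins C∪A∪B f ≡ true
        f∈C∪A∪B = ins-mono {C} {C∪A∪B} (λ v v∈C → ∨-trueˡ (∨-trueˡ v∈C)) f f∈C
        in-CA : ins C∪A∪B e ≡ true → ins C∪A e ≡ true
        in-CA h with edge-in-∪ {A = C∪A} {B} sparse₂ tCA tight-B t∈CA t∈B e e∈H₂ h
        ... | inj₁ y = y
        ... | inj₂ n = bool-contra n e∉B
        in-C : ins C∪A e ≡ true → ins C e ≡ true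
        in-C h with edge-in-∪ {A = C} {A} sparse₂ tC tight-A s∈C s∈A e e∈H₂ h
        ... | inj₁ y = y
        ... | inj₂ n = bool-contra n e∉A

      H′ : ESet
      H′ = swap f e H₂

      dg₂-A : ∀ v → A v ≡ true → dg H₂ v ≡ dg HA v
      dg₂-A v v∈A = dg-cong v λ i vi → H₂-HA i (outside-of {B} v i vi (disjoint v v∈A))

      dg₂-B : ∀ v → B v ≡ true → dg H₂ v ≡ dg HB v
      dg₂-B v v∈B = dg-cong v λ i vi → H₂-HB i (outside-of {A} v i vi (disjoint′ v v∈B))

      dg₂-outside : ∀ v → A v ≡ false → B v ≡ false → dg H₂ v ≡ dg H v
      dg₂-outside v v∉A v∉B = dg-cong v λ i vi → H₂-outside i (outside-of {A} v i vi v∉A) (outside-of {B} v i vi v∉B)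

      dg′≤ : ∀ v → dg H′ v ≤ dg H₂ v + ι (inc v f)
      dg′≤ v = ≤-trans (m≤m+n _ _) (≤-reflexive (dg-swap f∉H₂ e∈H₂ v))

      switched : Switched ((A ∪ B) ∪ Q) w H′
      switched = record
        { sparse  = Sparse-swap f∉H₂ e∈H₂ sparse₂ tight∋e
        ; size    = trans size′ size₂
        ; outside = outside
        ; drop    = drop
        ; bounded = bounded
        }
        where
        size′ : cnt H′ ≡ cnt H₂
        size′ = +-cancelʳ-≡ 1 _ _ (trans (cong (_+ 1) (cnt-cong λ i → sym (∧-identityʳ (H′ i))))
          (trans (cnt-swap f∉H₂ e∈H₂ (λ _ → true)) (cong (_+ 1) (cnt-cong λ i → ∧-identityʳ (H₂ i)))))
        outside : ∀ i → ins ((A ∪ B) ∪ Q) i ≡ false → H′ i ≡ H i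
        outside i i∉ = begin
          H₂ i ∧ not (does (e ≟ i)) ∨ does (f ≟ i)   ≡⟨ cong₂ (λ b c → H₂ i ∧ not b ∨ c)
                                                          (dec-false (e ≟ i) λ { refl → bool-contra e∈Q i∉Q })
                                                          (dec-false (f ≟ i) λ { refl → bool-contra f∈Q i∉Q }) ⟩
          H₂ i ∧ true ∨ false                        ≡⟨ trans (∨-identityʳ _) (∧-identityʳ _) ⟩
          H₂ i                                       ≡⟨ H₂-outside i (ins-mono-false {A} {(A ∪ B) ∪ Q} (λ v h → ∨-trueˡ (∨-trueˡ h)) i i∉)
                                                          (ins-mono-false {B} {(A ∪ B) ∪ Q} (λ v h → ∨-trueˡ (∨-trueʳ {A v} h)) i i∉) ⟩
          H i                                        ∎
          where
          open ≡-Reasoning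
          i∉Q : ins Q i ≡ false
          i∉Q = ins-mono-false {Q} {(A ∪ B) ∪ Q} (⇉-∪ʳ {A = A ∪ B}) i i∉
        drop : dg H′ w < dg H w
        drop = ≤-reflexive (begin
          suc (dg H′ w)                    ≡⟨ +-comm 1 _ ⟩
          dg H′ w + 1                      ≡⟨ cong (λ b → dg H′ w + ι b) w∈e ⟨
          dg H′ w + ι (inc w e)            ≡⟨ dg-swap f∉H₂ e∈H₂ w ⟩
          dg H₂ w + ι (inc w f)            ≡⟨ cong (λ b → dg H₂ w + ι b) w∉f ⟩
          dg H₂ w + 0                      ≡⟨ +-identityʳ _ ⟩
          dg H₂ w                          ≡⟨ dg₂-outside w w∉A w∉B ⟩
          dg H w                           ∎)
          where
          open ≡-Reasoning
          w∉f : inc w f ≡ false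
          w∉f = cong₂ _∨_ (dec-false (src f ≟ w) λ { refl → bool-contra s∈A w∉A })
                          (dec-false (tgt f ≟ w) λ { refl → bool-contra t∈B w∉B })
        bounded : ∀ v → dg H′ v ≤ η v ⊎ dg H′ v ≤ dg H v
        -- An end of `f` was first pushed strictly below its bound, which pays for the one unit that
        -- `f` adds.
        bounded v with src f ≟ v | tgt f ≟ v | dg′≤ v
        ... | yes refl | _ | le = inj₁ (≤-trans le (≤-trans (≤-reflexive (+-comm _ 1))
                (subst (λ z → suc z ≤ η v) (sym (dg₂-A v s∈A)) RA.drop)))
        ... | no _ | yes refl | le = inj₁ (≤-trans le (≤-trans (≤-reflexive (+-comm _ 1))
                (subst (λ z → suc z ≤ η v) (sym (dg₂-B v t∈B)) RB.drop)))
        ... | no _ | no _ | le with A v in v?A | B v in v?B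
        ...   | true | _ = inj₁ (≤-trans le (≤-trans (≤-reflexive (trans (+-identityʳ _) (dg₂-A v v?A))) (RA.bounded v v?A)))
        ...   | false | true = inj₁ (≤-trans le (≤-trans (≤-reflexive (trans (+-identityʳ _) (dg₂-B v v?B))) (RB.bounded v v?B)))
        ...   | false | false = inj₂ (≤-trans le (≤-reflexive (trans (+-identityʳ _) (dg₂-outside v v?A v?B))))

-- Full sparse sets and the structure of an extremal one.

module Counting {n} (G : Graph n) where
  open Sparsity G
  open Degrees G
  open Colouring G using (MinTight; minTight)

  crosses : (Fin n → Fin n) → ESet
  crosses rep e = not (does (rep (tgt e) ≟ rep (src e)))

  roots : (Fin n → Fin n) → ℕ
  roots rep = cnt λ t → does (rep t ≟ t)

  -- Summing m|A| = E H A + m over the classes A of rep.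
  crossing-count : ∀ {m H} (rep : Fin n → Fin n) → (∀ v → rep (rep v) ≡ rep v) → Sparse m H →
    (∀ v → Tight m H (λ w → does (rep w ≟ rep v))) →
    cnt H + m * roots rep ≡ m * n + cnt (λ e → H e ∧ crosses rep e)
  crossing-count {m} {H} rep idem sp tight = begin
    cnt H + m * roots rep                                       ≡⟨ cong (_+ m * roots rep) (cnt-split H same) ⟩
    cnt (λ e → H e ∧ same e) + X + m * roots rep                ≡⟨ arith _ X (m * roots rep) ⟩
    cnt (λ e → H e ∧ same e) + m * roots rep + X                ≡⟨ cong (_+ X) (begin
      cnt (λ e → H e ∧ same e) + m * roots rep                  ≡⟨ cong₂ _+_ (sym edges) (trans (cong (m *_) (cnt-∑ _)) (sym (∑-* m _))) ⟩
      ∑ (λ t → E H (A t)) + ∑ (λ t → m * ι (does (rep t ≟ t)))  ≡⟨ ∑-+ _ _ ⟨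
      ∑ (λ t → E H (A t) + m * ι (does (rep t ≟ t)))            ≡⟨ ∑-cong each ⟩
      ∑ (λ t → m * cnt (A t))                                   ≡⟨ ∑-* m _ ⟩
      m * ∑ (λ t → cnt (A t))                                   ≡⟨ cong (m *_) vertices ⟩
      m * n                                                     ∎) ⟩
    m * n + X                                                   ∎
    where
    open ≡-Reasoning
    A : Fin n → VSet
    A t w = does (rep w ≟ t)
    same : ESet
    same e = does (rep (tgt e) ≟ rep (src e))
    X : ℕ
    X = cnt (λ e → H e ∧ not (same e))
    arith : ∀ a b c → a + b + c ≡ a + c + b
    arith = solve-∀

    each : ∀ t → E H (A t) + m * ι (does (rep t ≟ t)) ≡ m * cnt (A t)
    each t with rep t ≟ t
    ... | yes rt≡t = trans (cong (E H (A t) +_) (*-identityʳ m)) (Sparse-tight {A = A t} {t} sp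
            (Tight-cong {A = λ w → does (rep w ≟ rep t)} {A t} (λ _ → refl) (λ w → cong (λ z → does (rep w ≟ z)) rt≡t) (tight t))
            (dec-true (rep t ≟ t) rt≡t))
    -- Classes are indexed by their representatives; any other `t` has an empty class and
    -- contributes nothing.
    ... | no rt≢t = trans (cong₂ _+_ (trans (E-def H (A t)) (cnt-zero λ e → trans (cong (λ b → H e ∧ b ∧ A t (tgt e)) (empty (src e))) (∧-zeroʳ (H e))))
            (*-zeroʳ m)) (sym (trans (cong (m *_) (cnt-zero empty)) (*-zeroʳ m)))
      where
      empty : ∀ w → A t w ≡ false
      empty w = dec-false (rep w ≟ t) λ rw≡t → rt≢t (trans (cong rep (sym rw≡t)) (trans (idem w) rw≡t))

    vertices : ∑ (λ t → cnt (A t)) ≡ n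
    vertices = trans (∑-cong (λ t → cnt-∑ (A t))) (trans (∑-swap (λ t w → ι (A t w)))
      (trans (∑-cong one) (trans (∑-const n 1) (*-identityʳ n))))
      where
      one : ∀ w → ∑ (λ t → ι (does (rep w ≟ t))) ≡ 1
      one w = trans (sym (cnt-∑ _)) (trans (cnt-cong λ t → sym (∧-identityʳ _)) (cnt-singleton (rep w) (λ _ → true)))

    edges : ∑ (λ t → E H (A t)) ≡ cnt (λ e → H e ∧ same e)
    edges = trans (∑-cong (λ t → trans (E-def H (A t)) (cnt-∑ _)))
      (trans (∑-swap (λ t e → ι (H e ∧ ins (A t) e))) (trans (∑-cong one) (sym (cnt-∑ _))))
      where
      bool : ∀ h a b → h ∧ a ∧ b ≡ a ∧ h ∧ b
      bool = toWitness {a? = ∀Bool? λ h → ∀Bool? λ a → ∀Bool? λ b → h ∧ a ∧ b Data.Bool.≟ _} _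
      one : ∀ e → ∑ (λ t → ι (H e ∧ ins (A t) e)) ≡ ι (H e ∧ same e)
      one e = trans (sym (cnt-∑ _)) (trans (cnt-cong λ t → bool (H e) (A t (src e)) (A t (tgt e)))
        (cnt-singleton (rep (src e)) (λ t → H e ∧ A t (tgt e))))

  Tight-single : ∀ {m H} v → Tight m H (λ w → does (v ≟ w))
  Tight-single {m} v = ≤-trans (≤-reflexive (trans (cong (m *_)
    (trans (cnt-cong λ w → sym (∧-identityʳ _)) (cnt-singleton v (λ _ → true)))) (*-identityʳ m))) (m≤n+m m _)

  -- In a largest sparse `H`, an edge between different maximal tight sets must belong to `H`, since
  -- otherwise it could be inserted. Counting over this partition then turns the cut condition into
  -- the required number of edges.
  full-sparse : ∀ m → Fin n → (∀ rep → (∀ v → rep (rep v) ≡ rep v) → m * roots rep ≤ cnt (crosses rep) + m) →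
         ¬ ¬ ∃ λ H → Sparse m H × cnt H + m ≡ m * n
  full-sparse m v₀ cut = do
    H , sp , largest ← argmin (Sparse m) (λ H → cnt (not ∘ H)) (λ _ → false) Sparse-∅
    P ← partition (Tight m H) Tight-single (λ A B v tA tB v∈A v∈B → Tight-∪ {A = A} {B} sp tA tB v∈A v∈B)
    inTight? ← ¬¬-∀Fin λ f → em (∃ λ A → Tight m H A × ins A f ≡ true)
    pure (H , sp , full H sp largest P inTight?)
    where
    module _ (H : ESet) (sp : Sparse m H) (largest : ∀ K → Sparse m K → cnt (not ∘ H) ≤ cnt (not ∘ K))
             (P : Partition (Tight m H)) (inTight? : ∀ f → Dec (∃ λ A → Tight m H A × ins A f ≡ true)) where
      open Partition P

      crossing∈H : ∀ f → crosses rep f ≡ true → H f ≡ true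
      crossing∈H f cf with H f in f∉H
      ... | true = refl
      ... | false with inTight? f
      ...   | yes (A , tA , f∈A) = bool-contra cf (cong not (dec-true (rep (tgt f) ≟ rep (src f))
                (rep-within A tA (tgt f) (src f) (∧-trueʳ {A (src f)} f∈A) (∧-trueˡ {A (src f)} f∈A))))
      ...   | no ¬t = bool-contra
                (cnt-reflects-⇉ {p = not ∘ insert f H} {not ∘ H} (λ e → not-∨ˡ (H e))
                  (largest (insert f H) (Sparse-insert sp f∉H λ A tA f∈A → ¬t (A , tA , f∈A))) f (cong not f∉H))
                (cong not (∨-trueʳ {H f} (dec-true (f ≟ f) refl)))

      full : cnt H + m ≡ m * n
      full = ≤-antisym
        (subst₂ (λ a b → a + m ≤ m * b) (E-all H) (cnt-all n) (sp (λ _ → true) v₀ refl))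
        (linear 0 (+-mono-≤ (≤-reflexive (sym count)) (cut rep rep-idem)) (arith (cnt H) m (m * roots rep) (m * n) (cnt (crosses rep))))
        where
        count : cnt H + m * roots rep ≡ m * n + cnt (crosses rep)
        count = trans (crossing-count rep rep-idem sp λ v → let C , tC , eq = rep-class v in Tight-cong {A = C} (λ _ → refl) eq tC)
          (cong (m * n +_) (cnt-cong λ e → absorb (crossing∈H e)))
          where
          absorb : ∀ {h c} → (c ≡ true → h ≡ true) → h ∧ c ≡ c
          absorb {h} {true}  f rewrite f refl = refl
          absorb {h} {false} f = ∧-zeroʳ h
        arith : ∀ h m r n c → n + (h + r + (c + m)) + 0 ≡ h + m + (n + c + r)
        arith = solve-∀

  -- Here `S` stands for the vertices in no nice set. These are the facts about an extremal `H` that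
  -- the degree count contradicts once some vertex exceeds its bound.
  record Obstruction (m : ℕ) (η : Fin n → ℕ) (H : ESet) : Set where
    field
      S           : VSet
      rep         : Fin n → Fin n
      idem        : ∀ v → rep (rep v) ≡ rep v
      class-tight : ∀ v → Tight m H (λ w → does (rep w ≟ rep v))
      S-single    : ∀ s w → S s ≡ true → rep w ≡ rep s → w ≡ s
      S-degree    : ∀ v → S v ≡ true → η v ≤ dg H v
      overfull∈S  : ∀ v → η v < dg H v → S v ≡ true
      within      : ∀ f → H f ≡ false → S (src f) ≡ false → S (tgt f) ≡ false → rep (src f) ≡ rep (tgt f)

  excess : (Fin n → ℕ) → ESet → ℕ
  excess η H = ∑ λ v → dg H v ∸ η v

  module Extremal (m : ℕ) .{{_ : NonZero m}} (η : Fin n → ℕ) (H : ESet) (sp : Sparse m H)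
    (full : Tight m H (λ _ → true))
    (minimal : ∀ K → Sparse m K × cnt K ≡ cnt H → excess η H ≤ excess η K) where
    open Exchange m η H sp

    -- A switch at a vertex above its bound would strictly lower the excess, against minimality.
    not-overfull : ∀ {D w H′} → Switched D w H′ → dg H w ≤ η w
    not-overfull {D} {w} {H′} sw = ≮⇒≥ λ over → <⇒≱ (less over) (minimal H′ (SW.sparse , SW.size))
      where
      module SW = Switched sw
      no-worse : ∀ v → dg H′ v ∸ η v ≤ dg H v ∸ η v
      no-worse v with SW.bounded v
      ... | inj₁ ≤η = subst (_≤ dg H v ∸ η v) (sym (m≤n⇒m∸n≡0 ≤η)) z≤n
      ... | inj₂ ≤d = ∸-monoˡ-≤ (η v) ≤d
      less : η w < dg H w → excess η H′ < excess η H
      less over = ∑-mono-< no-worse w (strictly (dg H′ w) (dg H w) (η w) SW.drop over)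
        where
        strictly : ∀ a b c → a < b → c < b → a ∸ c < b ∸ c
        strictly a b c a<b c<b with ≤-total c a
        ... | inj₁ c≤a = ∸-monoˡ-< a<b c≤a
        ... | inj₂ a≤c = subst (_< b ∸ c) (sym (m≤n⇒m∸n≡0 a≤c)) (m<n⇒0<n∸m c<b)

    -- If `A` and `B` meet, their union is nice. Otherwise the least tight set around `f` is added
    -- to it: each new vertex admits a switch, so it is within its bound and can be pushed below it.
    merge : ∀ {A B} f → H f ≡ false → Nice A → Nice B → A (src f) ≡ true → B (tgt f) ≡ true →
            ¬ ¬ ∃ λ D → Nice D × ins D f ≡ true
    merge {A} {B} f f∉H nA nB s∈A t∈B = do
      no disjoint ← em (∃ λ v → A v ≡ true × B v ≡ true)
        where yes (v , v∈A , v∈B) → pure (A ∪ B , Nice-∪ nA nB v∈A v∈B , ∧-true (∨-trueˡ s∈A) (∨-trueʳ {A (tgt f)} t∈B))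
      -- The whole vertex set is tight because `H` is full, so a least tight set around `f` exists.
      Q , tQ , f∈Q , minQ ← minTight {A = λ _ → true} sp full refl
      pure (union disjoint Q tQ f∈Q minQ)
      where
      module _ (disjoint : ¬ ∃ λ v → A v ≡ true × B v ≡ true) (Q : VSet) (tQ : Tight m H Q)
               (f∈Q : ins Q f ≡ true) (minQ : ∀ C → Tight m H C → ins C f ≡ true → Q ⇉ C) where
        D : VSet
        D = (A ∪ B) ∪ Q

        A⇉D : A ⇉ D
        A⇉D v v∈A = ∨-trueˡ (∨-trueˡ v∈A)

        B⇉D : B ⇉ D
        B⇉D v v∈B = ∨-trueˡ (∨-trueʳ {A v} v∈B)

        data Part (w : Fin n) : Set where
          inA  : A w ≡ true → Part w
          inB  : B w ≡ true → Part w
          away : ∃ (Switched D w) → Part w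

        part : ∀ w → D w ≡ true → Part w
        part w w∈D with A w in w?A | B w in w?B
        ... | true  | _    = inA w?A
        ... | false | true = inB w?B
        ... | false | false = away (Sw.H′ , Sw.switched)
          where module Sw = Switch nA nB (λ v v∈A → ¬true⇒false λ v∈B → disjoint (v , v∈A , v∈B)) f f∉H s∈A t∈B tQ f∈Q minQ w w∈D w?A w?B

        bounded : ∀ v → D v ≡ true → dg H v ≤ η v
        bounded v v∈D with part v v∈D
        ... | inA v∈A = Nice.bounded nA v v∈A
        ... | inB v∈B = Nice.bounded nB v v∈B
        ... | away (_ , sw) = not-overfull sw

        reducible : ∀ w → D w ≡ true → ∃ (Reduced D w)
        reducible w w∈D with part w w∈D
        ... | inA w∈A = let K , r = Nice.reducible nA w w∈A in K , Reduced-⇉ A⇉D bounded r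
        ... | inB w∈B = let K , r = Nice.reducible nB w w∈B in K , Reduced-⇉ B⇉D bounded r
        -- By `not-overfull` a drop below the old degree is also a drop below the bound.
        ... | away (K , sw) = K , record
          { sparse  = SW.sparse
          ; size    = SW.size
          ; outside = SW.outside
          ; drop    = <-≤-trans SW.drop (not-overfull sw)
          ; bounded = λ v v∈D → below v v∈D (SW.bounded v)
          }
          where
          module SW = Switched sw
          below : ∀ v → D v ≡ true → dg K v ≤ η v ⊎ dg K v ≤ dg H v → dg K v ≤ η v
          below v v∈D (inj₁ le) = le
          below v v∈D (inj₂ le) = ≤-trans le (bounded v v∈D)

        union : ∃ λ D → Nice D × ins D f ≡ true
        union = D , record { tight = tight ; bounded = bounded ; reducible = reducible } , ins-mono {A = Q} (⇉-∪ʳ {A = A ∪ B}) f f∈Q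
          where
          tight : Tight m H D
          tight = Tight-cong {A = A ∪ (Q ∪ B)} (λ _ → refl) (λ v → rearrange (A v) (Q v) (B v))
            (Tight-∪ {A = A} {Q ∪ B} sp (Nice.tight nA)
              (Tight-∪ {A = Q} {B} sp tQ (Nice.tight nB) (∧-trueʳ {Q (src f)} f∈Q) t∈B)
              s∈A (∨-trueˡ (∧-trueˡ {Q (src f)} f∈Q)))
            where
            rearrange : ∀ a q b → a ∨ (q ∨ b) ≡ (a ∨ b) ∨ q
            rearrange = toWitness {a? = ∀Bool? λ a → ∀Bool? λ q → ∀Bool? λ b → a ∨ (q ∨ b) Data.Bool.≟ _} _

    Joined : Fin n → Fin n → Set
    Joined v w = ∃ λ C → Nice C × C v ≡ true × C w ≡ true

    -- Contains the singletons, so cells partition all vertices, those in no nice set being alone in their class.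
    Cell : VSet → Set
    Cell C = Tight m H C × (∀ v w → C v ≡ true → C w ≡ true → v ≡ w ⊎ Joined v w)

    Cell-single : ∀ v → Cell (λ w → does (v ≟ w))
    Cell-single v = Tight-single v , λ u w v≡u v≡w → inj₁ (trans (sym (does-true (v ≟ u) v≡u)) (does-true (v ≟ w) v≡w))

    -- Being joined is transitive because nice sets with a common vertex have a nice union, so
    -- everything is linked through `t`.
    Cell-∪ : ∀ A B t → Cell A → Cell B → A t ≡ true → B t ≡ true → Cell (A ∪ B)
    Cell-∪ A B t (tA , jA) (tB , jB) t∈A t∈B = Tight-∪ {A = A} {B} sp tA tB t∈A t∈B , joined
      where
      sym-J : ∀ {v w} → v ≡ w ⊎ Joined v w → w ≡ v ⊎ Joined w v
      sym-J (inj₁ eq) = inj₁ (sym eq)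
      sym-J (inj₂ (C , nC , v∈C , w∈C)) = inj₂ (C , nC , w∈C , v∈C)
      trans-J : ∀ {u v w} → u ≡ v ⊎ Joined u v → v ≡ w ⊎ Joined v w → u ≡ w ⊎ Joined u w
      trans-J (inj₁ refl) j = j
      trans-J j (inj₁ refl) = j
      trans-J (inj₂ (C , nC , u∈C , v∈C)) (inj₂ (D , nD , v∈D , w∈D)) =
        inj₂ (C ∪ D , Nice-∪ nC nD v∈C v∈D , ∨-trueˡ u∈C , ∨-trueʳ {C _} w∈D)
      to-t : ∀ v → (A ∪ B) v ≡ true → v ≡ t ⊎ Joined v t
      to-t v v∈ with ∨-split {A v} v∈
      ... | inj₁ v∈A = jA v t v∈A t∈A
      ... | inj₂ v∈B = jB v t v∈B t∈B
      joined : ∀ v w → (A ∪ B) v ≡ true → (A ∪ B) w ≡ true → v ≡ w ⊎ Joined v w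
      joined v w v∈ w∈ = trans-J (to-t v v∈) (sym-J (to-t w w∈))

    obstruction : ¬ ¬ Obstruction m η H
    obstruction = do
      P ← partition Cell Cell-single Cell-∪
      D ← ¬¬-∀Fin λ v → em (Joined v v)
      pure (build P D)
      where
      module _ (P : Partition Cell) (D : ∀ v → Dec (Joined v v)) where
        open Partition P

        S : VSet
        S v = not (does (D v))

        nowhere : ∀ {v} → S v ≡ true → ¬ Joined v v
        nowhere {v} v∈S = does-false (D v) (not-true v∈S)

        somewhere : ∀ {v} → S v ≡ false → Joined v v
        somewhere {v} v∉S = does-true (D v) (not-false v∉S)

        build : Obstruction m η H
        build = record
          { S           = S
          ; rep         = rep
          ; idem        = rep-idem
          ; class-tight = λ v → let C , (tC , _) , eq = rep-class v in Tight-cong {A = C} (λ _ → refl) eq tC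
          ; S-single    = single
          ; S-degree    = λ v v∈S → ≮⇒≥ λ d<η → nowhere v∈S (alone v d<η)
          ; overfull∈S  = λ v over → cong not (dec-false (D v) λ (C , nC , v∈C , _) → <⇒≱ over (Nice.bounded nC v v∈C))
          ; within      = λ f f∉H s∉S t∉S → together f f∉H (somewhere s∉S) (somewhere t∉S)
          }
          where
          -- Distinct vertices of one cell share a nice set, and a vertex of `S` lies in none.
          single : ∀ s w → S s ≡ true → rep w ≡ rep s → w ≡ s
          single s w s∈S eq with rep-class s
          ... | C , (_ , joined) , class with joined w s (trans (class w) (dec-true (rep w ≟ rep s) eq))
                                                        (trans (class s) (dec-true (rep s ≟ rep s) refl))
          ...   | inj₁ w≡s = w≡s
          ...   | inj₂ (A , nA , _ , s∈A) = ⊥-elim (nowhere s∈S (A , nA , s∈A , s∈A))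

          -- A vertex strictly below its bound is a nice set by itself, with `H` as its own
          -- reduction.
          alone : ∀ v → dg H v < η v → Joined v v
          alone v d<η = (λ w → does (v ≟ w)) , record
            { tight     = Tight-single v
            ; bounded   = bounded
            ; reducible = λ w v≡w → H , record
              { sparse = sp ; size = refl ; outside = λ _ _ → refl
              ; drop = subst (λ z → dg H z < η z) (does-true (v ≟ w) v≡w) d<η ; bounded = bounded }
            } , dec-true (v ≟ v) refl , dec-true (v ≟ v) refl
            where
            bounded : ∀ w → does (v ≟ w) ≡ true → dg H w ≤ η w
            bounded w v≡w = subst (λ z → dg H z ≤ η z) (does-true (v ≟ w) v≡w) (<⇒≤ d<η)

          -- Merging puts both ends of `f` into one nice set; that set is a cell and therefore lies
          -- within one class.
          together : ∀ f → H f ≡ false → Joined (src f) (src f) → Joined (tgt f) (tgt f) → rep (src f) ≡ rep (tgt f)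
          together f f∉H (A , nA , s∈A , _) (B , nB , t∈B , _) = Fin-stable do
            C , nC , f∈C ← merge f f∉H nA nB s∈A t∈B
            pure (rep-within C (Nice.tight nC , λ v w v∈C w∈C → inj₂ (C , nC , v∈C , w∈C)) (src f) (tgt f)
              (∧-trueˡ {C (src f)} f∈C) (∧-trueʳ {C (src f)} f∈C))
            where
            Fin-stable : ∀ {v w : Fin n} → ¬ ¬ v ≡ w → v ≡ w
            Fin-stable {v} {w} ¬¬eq with v ≟ w
            ... | yes eq = eq
            ... | no neq = ⊥-elim (¬¬eq neq)

-- Degree sums over the exceptional vertices.

module DegreeCount {n} (G : Graph n) where
  open Sparsity G
  open Degrees G
  open Counting G

  all : ESet
  all _ = true

  -- Double counting of incidences; since the two ends of an edge differ, sources and targets can be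
  -- counted separately.
  degree-sum : ∀ H (S : VSet) → ∑ (λ v → ι (S v) * dg H v) ≡ cnt (λ e → H e ∧ S (src e)) + cnt (λ e → H e ∧ S (tgt e))
  degree-sum H S = begin
    ∑ (λ v → ι (S v) * dg H v)                                           ≡⟨ ∑-cong select ⟩
    ∑ (λ v → ∑ λ e → ι (S v ∧ H e ∧ inc v e))                            ≡⟨ ∑-swap (λ v e → ι (S v ∧ H e ∧ inc v e)) ⟩
    ∑ (λ e → ∑ λ v → ι (S v ∧ H e ∧ inc v e))                            ≡⟨ ∑-cong both-ends ⟩
    ∑ (λ e → ι (H e ∧ S (src e)) + ι (H e ∧ S (tgt e)))                  ≡⟨ ∑-+ _ _ ⟩
    ∑ (λ e → ι (H e ∧ S (src e))) + ∑ (λ e → ι (H e ∧ S (tgt e)))        ≡⟨ cong₂ _+_ (cnt-∑ _) (cnt-∑ _) ⟨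
    cnt (λ e → H e ∧ S (src e)) + cnt (λ e → H e ∧ S (tgt e))            ∎
    where
    open ≡-Reasoning
    select : ∀ v → ι (S v) * dg H v ≡ ∑ (λ e → ι (S v ∧ H e ∧ inc v e))
    select v with S v
    ... | true  = trans (*-identityˡ _) (trans (dg-def H v) (cnt-∑ _))
    ... | false = trans (sym (cnt-zero λ _ → refl)) (cnt-∑ _)
    bool : ∀ s h a b → a ∧ b ≡ false → ι (s ∧ h ∧ (a ∨ b)) ≡ ι (a ∧ h ∧ s) + ι (b ∧ h ∧ s)
    bool s h a b = toWitness {a? = ∀Bool? λ s → ∀Bool? λ h → ∀Bool? λ a → ∀Bool? λ b →
      (a ∧ b Data.Bool.≟ false) →-dec (ι (s ∧ h ∧ (a ∨ b)) ℕ.≟ ι (a ∧ h ∧ s) + ι (b ∧ h ∧ s))} _ s h a b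
    both-ends : ∀ e → ∑ (λ v → ι (S v ∧ H e ∧ inc v e)) ≡ ι (H e ∧ S (src e)) + ι (H e ∧ S (tgt e))
    both-ends e = trans (sym (cnt-∑ _)) (trans
      (cnt-+ λ v → bool (S v) (H e) (does (src e ≟ v)) (does (tgt e ≟ v)) (distinct v))
      (cong₂ _+_ (cnt-singleton (src e) (λ v → H e ∧ S v)) (cnt-singleton (tgt e) (λ v → H e ∧ S v))))
      where
      distinct : ∀ v → does (src e ≟ v) ∧ does (tgt e ≟ v) ≡ false
      distinct v with src e ≟ v | tgt e ≟ v
      ... | yes refl | yes eq = ⊥-elim (loopless G e (sym eq))
      ... | yes _    | no _   = refl
      ... | no _     | _      = refl

  free-crosses : (Fin n → Fin n) → VSet → ESet
  free-crosses rep S e = crosses rep e ∧ not (S (src e)) ∧ not (S (tgt e))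

  Singletons : (Fin n → Fin n) → VSet → Set
  Singletons rep S = ∀ s w → S s ≡ true → rep w ≡ rep s → w ≡ s

  src-crosses : ∀ {rep S} → Singletons rep S → ∀ e → S (src e) ≡ true → crosses rep e ≡ true
  src-crosses single e s∈S = cong not (dec-false (_ ≟ _) λ eq → loopless G e (sym (single (src e) (tgt e) s∈S eq)))

  tgt-crosses : ∀ {rep S} → Singletons rep S → ∀ e → S (tgt e) ≡ true → crosses rep e ≡ true
  tgt-crosses single e t∈S = cong not (dec-false (_ ≟ _) λ eq → loopless G e (single (tgt e) (src e) t∈S (sym eq)))

  -- Every edge at `S` crosses, because vertices of `S` are alone in their classes. Summing degrees
  -- over `S` counts the edges inside `S` twice, which accounts for `E H S`.
  crossing-degrees : ∀ {H rep S} → Singletons rep S → (∀ e → free-crosses rep S e ≡ true → H e ≡ true) →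
    cnt (λ e → H e ∧ S (src e)) + cnt (λ e → H e ∧ S (tgt e)) + cnt (free-crosses rep S)
    ≡ cnt (λ e → H e ∧ crosses rep e) + E H S
  crossing-degrees {H} {rep} {S} single free∈H = trans
    (cnt-+-+-cong λ e → bool (H e) (S (src e)) (S (tgt e)) (crosses rep e)
      (src-crosses {S = S} single e) (tgt-crosses {S = S} single e) (free∈H e))
    (cong (_ +_) (sym (E-def H S)))
    where
    bool : ∀ h a b c → (a ≡ true → c ≡ true) → (b ≡ true → c ≡ true) → (c ∧ not a ∧ not b ≡ true → h ≡ true) →
           ι (h ∧ a) + ι (h ∧ b) + ι (c ∧ not a ∧ not b) ≡ ι (h ∧ c) + ι (h ∧ a ∧ b)
    bool = toWitness {a? = ∀Bool? λ h → ∀Bool? λ a → ∀Bool? λ b → ∀Bool? λ c →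
      ((a Data.Bool.≟ true) →-dec (c Data.Bool.≟ true)) →-dec
      (((b Data.Bool.≟ true) →-dec (c Data.Bool.≟ true)) →-dec
      (((c ∧ not a ∧ not b Data.Bool.≟ true) →-dec (h Data.Bool.≟ true)) →-dec
      (ι (h ∧ a) + ι (h ∧ b) + ι (c ∧ not a ∧ not b) ℕ.≟ _)))} _

  -- The cut estimate  k |R| + a e(S) ≤ Σ_{v ∈ S} d(v) + a p + k + (a - 1) k (|S| - 1)  with a = 1 + a′ and |S| = 1 + s,
  -- where R is the set of classes and p counts the crossing edges that avoid S;
  -- k-tree-connectivity gives it for a = 1 and k-edge-connectivity for a = 2.
  CutBound : ℕ → ℕ → Set
  CutBound k a′ = ∀ rep S s → (∀ v → rep (rep v) ≡ rep v) → Singletons rep S → cnt S ≡ suc s →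
    k * roots rep + suc a′ * E all S
    ≤ cnt (S ∘ src) + cnt (S ∘ tgt) + suc a′ * cnt (free-crosses rep S) + k + a′ * k * s

  -- The number `γ` controls the edges inside `S`. By `η-large` every vertex other than `u`
  -- satisfies m d(v) + β ≤ k η(v). The allowance at `u` is `pred k`, lost by the floor, plus the
  -- forgone `β`.
  module _ (m k j a′ γ : ℕ) (k≡ : k ≡ j + suc a′ * m) .{{_ : NonZero k}} (η : Fin n → ℕ) (u : Fin n)
    (cut : CutBound k a′)
    (slack : ∀ H S s → Sparse m H → cnt S ≡ suc s → (∀ v → S v ≡ true → η v ≤ dg all v) → j * E H S ≤ γ * s)
    (η-large : ∀ v → m * dg all v + (γ + a′ * k * m) ≤ k * η v + (ℕ.pred k + (γ + a′ * k * m)) * ι (does (u ≟ v))) where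

    private
      β : ℕ
      β = γ + a′ * k * m

    -- Combines the crossing edges of `H`, the degree sum over `S`, the cut bound, the edge counts
    -- inside `S` and the summed bounds `η`. The vertex `z` makes the comparison of degrees with
    -- bounds strict.
    no-obstruction : ∀ {H} → Sparse m H → cnt H + m ≡ m * n → Obstruction m η H → ∀ z → η z < dg H z → ⊥
    no-obstruction {H} sp full O z over with cnt S in cntS
      where open Obstruction O
    ... | zero = <⇒≢ (cnt-pos z (overfull∈S z over)) (sym cntS)
      where open Obstruction O
    ... | suc s = <⇒≱ ≤-refl (final {k} {j} k≡ crossing degrees (cut rep S s idem S-single cntS) E-mono
                    (slack H S s sp cntS λ v v∈S → ≤-trans (S-degree v v∈S) (dg-mono v λ _ _ → refl)) η-sum over-sum)
      where
      open Obstruction O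
      Dη DH D X e eG p : ℕ
      Dη = ∑ λ v → ι (S v) * η v
      DH = cnt (λ e → H e ∧ S (src e)) + cnt (λ e → H e ∧ S (tgt e))
      D  = cnt (S ∘ src) + cnt (S ∘ tgt)
      X  = cnt (λ e → H e ∧ crosses rep e)
      e  = E H S
      eG = E all S
      p  = cnt (free-crosses rep S)

      crossing : m * roots rep ≡ X + m
      crossing = +-cancelˡ-≡ (cnt H) _ _ (begin
        cnt H + m * roots rep    ≡⟨ crossing-count rep idem sp class-tight ⟩
        m * n + X                ≡⟨ cong (_+ X) full ⟨
        cnt H + m + X            ≡⟨ arith (cnt H) m X ⟩
        cnt H + (X + m)          ∎)
        where
        open ≡-Reasoning
        arith : ∀ h m x → h + m + x ≡ h + (x + m)
        arith = solve-∀

      degrees : DH + p ≡ X + e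
      degrees = crossing-degrees {H} {rep} {S} S-single λ f free → bool-stable λ f∉H →
        bool-contra (∧-trueˡ {crosses rep f} free) (cong not (dec-true (_ ≟ _) (sym (within f (¬true⇒false f∉H)
          (not-true (∧-trueˡ {not (S (src f))} (∧-trueʳ {crosses rep f} free)))
          (not-true (∧-trueʳ {not (S (src f))} (∧-trueʳ {crosses rep f} free)))))))

      E-mono : e ≤ eG
      E-mono = subst₂ _≤_ (sym (E-def H S)) (sym (E-def all S)) (cnt-mono λ f → ∧-trueʳ {H f})

      over-sum : suc Dη ≤ DH
      over-sum = subst (suc Dη ≤_) (degree-sum H S) (∑-mono-< (λ v → each v) z
        (subst (λ b → ι b * η z < ι b * dg H z) (sym (overfull∈S z over)) (subst₂ _<_ (sym (*-identityˡ _)) (sym (*-identityˡ _)) over)))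
        where
        each : ∀ v → ι (S v) * η v ≤ ι (S v) * dg H v
        each v with S v in v?S
        ... | true  = *-monoʳ-≤ 1 (S-degree v v?S)
        ... | false = z≤n

      η-sum : m * D + β * suc s ≤ k * Dη + (ℕ.pred k + β)
      η-sum = subst₂ _≤_ lhs rhs (∑-mono each)
        where
        each : ∀ v → m * (ι (S v) * dg all v) + β * ι (S v) ≤ k * (ι (S v) * η v) + (ℕ.pred k + β) * ι (does (u ≟ v))
        each v with S v
        ... | true  = subst₂ _≤_ (cong₂ (λ a b → m * a + b) (sym (*-identityˡ _)) (sym (*-identityʳ β)))
                        (cong (λ a → k * a + (ℕ.pred k + β) * ι (does (u ≟ v))) (sym (*-identityˡ _))) (η-large v)
        ... | false = subst (_≤ k * 0 + (ℕ.pred k + β) * ι (does (u ≟ v))) (sym (cong₂ _+_ (*-zeroʳ m) (*-zeroʳ β))) z≤n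
        lhs : ∑ (λ v → m * (ι (S v) * dg all v) + β * ι (S v)) ≡ m * D + β * suc s
        lhs = trans (∑-+ _ _) (cong₂ _+_ (trans (∑-* m _) (cong (m *_) (degree-sum all S)))
          (trans (∑-* β _) (cong (β *_) (trans (sym (cnt-∑ S)) cntS))))
        rhs : ∑ (λ v → k * (ι (S v) * η v) + (ℕ.pred k + β) * ι (does (u ≟ v))) ≡ k * Dη + (ℕ.pred k + β)
        rhs = trans (∑-+ _ _) (cong₂ _+_ (∑-* k _) (trans (∑-* (ℕ.pred k + β) _) (trans
          (cong ((ℕ.pred k + β) *_) (trans (sym (cnt-∑ _)) (trans (cnt-cong λ v → sym (∧-identityʳ _)) (cnt-singleton u (λ _ → true)))))
          (*-identityʳ _))))

      final : ∀ {k j R X DH p e eG D s Dη} → .{{_ : NonZero k}} → k ≡ j + suc a′ * m → m * R ≡ X + m → DH + p ≡ X + e →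
        k * R + suc a′ * eG ≤ D + suc a′ * p + k + a′ * k * s → e ≤ eG → j * e ≤ γ * s →
        m * D + (γ + a′ * k * m) * suc s ≤ k * Dη + (ℕ.pred k + (γ + a′ * k * m)) → suc Dη ≤ DH → 1 ≤ 0
      final {k} {j} {R} {X} {DH} {p} {e} {eG} {D} {s} {Dη} k≡ h1 h2 h3 h4 h5 h6 h7 =
        combine (j + suc a′ * m) refl
          (subst (λ k → k * R + suc a′ * eG ≤ D + suc a′ * p + k + a′ * k * s) k≡ h3)
          (subst (λ k → suc (m * D + (γ + a′ * k * m) * suc s) ≤ k * Dη + (k + (γ + a′ * k * m))) k≡ h6′)
        where
        h6′ : suc (m * D + (γ + a′ * k * m) * suc s) ≤ k * Dη + (k + (γ + a′ * k * m))
        h6′ = ≤-trans (s≤s h6) (≤-reflexive (trans (sym (+-suc (k * Dη) _)) (cong (λ z → k * Dη + (z + (γ + a′ * k * m))) (suc-pred k))))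
        combine : ∀ K → K ≡ j + suc a′ * m →
          K * R + suc a′ * eG ≤ D + suc a′ * p + K + a′ * K * s →
          suc (m * D + (γ + a′ * K * m) * suc s) ≤ K * Dη + (K + (γ + a′ * K * m)) → 1 ≤ 0
        -- The weights are `K` for `h1`, `h2` and `h7`, `m` for `h3`, `suc a′ * m` for `h4`, and one
        -- for `h5` and `h6`. The edges avoiding `S` remain with the nonnegative coefficient `j`.
        combine K refl h3 h6 = linear (j * p)
          (+-mono-≤ (+-mono-≤ (+-mono-≤ (*-monoʳ-≤ K (≤-reflexive (sym h1))) (*-monoʳ-≤ K (≤-reflexive h2))) (+-mono-≤ (*-monoʳ-≤ m h3) (*-monoʳ-≤ (suc a′ * m) h4)))
            (+-mono-≤ (+-mono-≤ h5 h6) (*-monoʳ-≤ K h7)))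
          (identity j a′ m R X DH p e eG D s Dη γ)
          where
          identity : ∀ j a m R X DH p e eG D s Dη γ →
            1 + ((j + (1 + a) * m) * (m * R) + (j + (1 + a) * m) * (X + e)
                 + (m * (D + (1 + a) * p + (j + (1 + a) * m) + a * (j + (1 + a) * m) * s) + (1 + a) * m * eG)
                 + (γ * s + ((j + (1 + a) * m) * Dη + ((j + (1 + a) * m) + (γ + a * (j + (1 + a) * m) * m))) + (j + (1 + a) * m) * DH))
              + j * p
            ≡ 0 + ((j + (1 + a) * m) * (X + m) + (j + (1 + a) * m) * (DH + p)
                 + (m * ((j + (1 + a) * m) * R + (1 + a) * eG) + (1 + a) * m * e)
                 + (j * e + (1 + (m * D + (γ + a * (j + (1 + a) * m) * m) * (1 + s))) + (j + (1 + a) * m) * (1 + Dη)))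
          identity = solve-∀

-- Cut bounds from the two kinds of connectivity.

cnt-mono-< : ∀ {n} {p q : Fin n → Bool} → p ⇉ q → ∀ i → p i ≡ false → q i ≡ true → cnt p < cnt q
cnt-mono-< p⇉q i pi qi = ≰⇒> λ q≤p → bool-contra (cnt-reflects-⇉ p⇉q q≤p i qi) pi

card : ∀ {n} (S : Subset n) → ∣ S ∣ ≡ cnt (lookup S)
card Vec.[]          = sym (trans (cnt-∑ _) (∑-zero _))
card (true  Vec.∷ S) = trans (cong suc (card S)) (sym (cnt-suc _))
card (false Vec.∷ S) = trans (card S) (sym (cnt-suc _))

module Cuts {n} (G : Graph n) where
  open Sparsity G
  open Degrees G
  open Counting G
  open DegreeCount G

  reach-crosses : ∀ {T x y} → Reach G T x y → (B : VSet) → B x ≡ true → B y ≡ false →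
                  ∃ λ e → lookup T e ≡ true × B (src e) xor B (tgt e) ≡ true
  reach-crosses here B x∈B x∉B = bool-contra x∈B x∉B
  reach-crosses (step {y} e e∈T joins r) B x∈B z∉B with B y in y?B
  ... | false = reach-crosses r B x∈B y?B
  ... | true  = e , []=⇒lookup e∈T , across joins
    where
    across : Joins G e y _ → B (src e) xor B (tgt e) ≡ true
    across (inj₁ (refl , refl)) = cong₂ _xor_ y?B z∉B
    across (inj₂ (refl , refl)) = cong₂ _xor_ z∉B y?B

  Idempotent : (Fin n → Fin n) → Set
  Idempotent rep = ∀ v → rep (rep v) ≡ rep v

  roots≤1 : ∀ {rep} → (∀ v w → rep v ≡ rep w) → roots rep ≤ 1
  roots≤1 {rep} same = cnt≤1 _ λ v w v-root w-root →
    trans (sym (does-true (rep v ≟ v) v-root)) (trans (same v w) (does-true (rep w ≟ w) w-root))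

  -- Induction on the crossing edges of `T`: contracting one merges two classes, which costs one
  -- root and at least one crossing edge. With none left, connectivity leaves at most one class.
  tree-roots : ∀ {T} → Connected G T → ∀ rep → Idempotent rep →
               roots rep ≤ cnt (λ e → lookup T e ∧ crosses rep e) + 1
  tree-roots {T} conn rep idem = go (suc (cnt (X rep))) rep idem ≤-refl
    where
    X : (Fin n → Fin n) → ESet
    X rep e = lookup T e ∧ crosses rep e

    go : ∀ N rep → Idempotent rep → cnt (X rep) < N → roots rep ≤ cnt (X rep) + 1
    go (suc N) rep idem (s≤s X≤N) with Fin.any? (λ e → X rep e Data.Bool.≟ true)
    ... | no ¬cross = ≤-trans (roots≤1 {rep} same) (m≤n+m 1 _)
      where
      same : ∀ v w → rep v ≡ rep w
      same v w with rep w ≟ rep v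
      ... | yes eq = sym eq
      ... | no neq with reach-crosses (conn v w) (λ z → does (rep z ≟ rep v)) (dec-true (rep v ≟ rep v) refl) (dec-false (rep w ≟ rep v) neq)
      ...   | e , e∈T , x = ⊥-elim (¬cross (e , ∧-true e∈T (cong not (dec-false (rep (tgt e) ≟ rep (src e))
                λ eq → bool-contra x (trans (cong (λ z → does (rep (src e) ≟ rep v) xor does (z ≟ rep v)) eq) (xor-same (does (rep (src e) ≟ rep v))))))))
    ... | yes (e , e∈X) = begin
      roots rep              ≤⟨ fewer-roots ⟩
      suc (roots rep′)       ≤⟨ s≤s (go N rep′ idem′ (<-≤-trans fewer X≤N)) ⟩
      suc (cnt (X rep′) + 1) ≤⟨ +-monoˡ-≤ 1 fewer ⟩
      cnt (X rep) + 1        ∎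
      where
      open ≤-Reasoning
      a b : Fin n
      a = rep (src e)
      b = rep (tgt e)
      b≢a : b ≢ a
      b≢a = does-false (b ≟ a) (not-true (∧-trueʳ {lookup T e} e∈X))
      rep′ : Fin n → Fin n
      rep′ v = if does (rep v ≟ b) then a else rep v
      rep′-b : ∀ v → rep v ≡ b → rep′ v ≡ a
      rep′-b v eq = cong (if_then a else rep v) (dec-true (rep v ≟ b) eq)
      rep′-other : ∀ v → rep v ≢ b → rep′ v ≡ rep v
      rep′-other v neq = cong (if_then a else rep v) (dec-false (rep v ≟ b) neq)
      rep′-a : rep′ a ≡ a
      rep′-a = trans (rep′-other a λ eq → b≢a (trans (sym eq) (idem (src e)))) (idem (src e))
      idem′ : Idempotent rep′
      idem′ v with rep v ≟ b
      ... | yes _ = rep′-a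
      ... | no neq = trans (rep′-other (rep v) λ eq → neq (trans (sym (idem v)) eq)) (idem v)
      rep′-cong : ∀ {v w} → rep v ≡ rep w → rep′ v ≡ rep′ w
      rep′-cong eq = cong (λ z → if does (z ≟ b) then a else z) eq
      fewer : cnt (X rep′) < cnt (X rep)
      fewer = cnt-mono-< sub e (trans (cong (lookup T e ∧_) (cong not (dec-true (_ ≟ _)
                (trans (rep′-b (tgt e) refl) (sym (rep′-other (src e) (b≢a ∘ sym))))))) (∧-zeroʳ _)) e∈X
        where
        sub : X rep′ ⇉ X rep
        sub i h = ∧-true (∧-trueˡ {lookup T i} h) (cong not (dec-false (_ ≟ _) λ eq →
          bool-contra (∧-trueʳ {lookup T i} h) (cong not (dec-true (_ ≟ _) (rep′-cong eq)))))
      fewer-roots : roots rep ≤ suc (roots rep′)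
      fewer-roots = begin
        roots rep                                                                  ≡⟨ cnt-split _ (λ t → does (b ≟ t)) ⟩
        cnt (λ t → does (rep t ≟ t) ∧ does (b ≟ t)) + cnt (λ t → does (rep t ≟ t) ∧ not (does (b ≟ t)))
          ≤⟨ +-mono-≤ (≤-trans (cnt-mono λ t h → ∧-true (∧-trueʳ {does (rep t ≟ t)} h) refl) (≤-reflexive (cnt-singleton b λ _ → true)))
                      (cnt-mono λ t h → stays t (does-true (rep t ≟ t) (∧-trueˡ {does (rep t ≟ t)} h)) (∧-trueʳ {does (rep t ≟ t)} h)) ⟩
        1 + roots rep′                                                             ∎
        where
        stays : ∀ t → rep t ≡ t → not (does (b ≟ t)) ≡ true → does (rep′ t ≟ t) ≡ true
        stays t rt≡t t≢b = dec-true (_ ≟ _) (trans (rep′-other t λ eq → bool-contra t≢b (cong not (dec-true (_ ≟ _) (trans (sym eq) rt≡t)))) rt≡t)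

  -- `tree-roots` is summed over the `k` trees; by disjointness each crossing edge is used at most
  -- once.
  packing-cut : ∀ {k} → GTreeConnected G k → ∀ rep → Idempotent rep → k * roots rep ≤ cnt (crosses rep) + k
  packing-cut {k} (T , trees , disjoint) rep idem = begin
    k * roots rep                                                           ≡⟨ ∑-const k _ ⟨
    ∑ {k} (λ _ → roots rep)                                                 ≤⟨ ∑-mono (λ i → tree-roots (proj₁ (proj₁ (trees i))) rep idem) ⟩
    ∑ {k} (λ i → cnt (λ e → lookup (T i) e ∧ crosses rep e) + 1)            ≡⟨ ∑-+ _ _ ⟩
    ∑ {k} (λ i → cnt (λ e → lookup (T i) e ∧ crosses rep e)) + ∑ {k} (λ _ → 1)  ≤⟨ +-mono-≤ once (≤-reflexive (trans (∑-const k 1) (*-identityʳ k))) ⟩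
    cnt (crosses rep) + k                                                   ∎
    where
    open ≤-Reasoning
    once : ∑ {k} (λ i → cnt (λ e → lookup (T i) e ∧ crosses rep e)) ≤ cnt (crosses rep)
    once = begin
      ∑ {k} (λ i → cnt (λ e → lookup (T i) e ∧ crosses rep e))        ≡⟨ ∑-cong (λ i → cnt-∑ _) ⟩
      ∑ {k} (λ i → ∑ (λ e → ι (lookup (T i) e ∧ crosses rep e)))      ≡⟨ ∑-swap (λ i e → ι (lookup (T i) e ∧ crosses rep e)) ⟩
      ∑ (λ e → ∑ {k} (λ i → ι (lookup (T i) e ∧ crosses rep e)))      ≤⟨ ∑-mono each ⟩
      ∑ (λ e → ι (crosses rep e))                                     ≡⟨ cnt-∑ _ ⟨
      cnt (crosses rep)                                               ∎
      where
      each : ∀ e → ∑ {k} (λ i → ι (lookup (T i) e ∧ crosses rep e)) ≤ ι (crosses rep e)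
      each e with crosses rep e
      ... | false = ≤-reflexive (trans (sym (cnt-∑ _)) (cnt-zero λ i → ∧-zeroʳ (lookup (T i) e)))
      ... | true  = subst (_≤ 1) (cnt-∑ _) (cnt≤1 _ λ i j hi hj → disjoint i j e (member i hi) (member j hj))
        where
        member : ∀ i → lookup (T i) e ∧ true ≡ true → e ∈ˢ T i
        member i h = lookup⇒[]= e (T i) (∧-trueˡ {lookup (T i) e} h)

  all-crossing-degrees : ∀ {rep S} → Singletons rep S →
    cnt (S ∘ src) + cnt (S ∘ tgt) + cnt (free-crosses rep S) ≡ cnt (crosses rep) + E all S
  all-crossing-degrees {rep} {S} single = crossing-degrees {all} {rep} {S} single λ _ _ → refl

  packing-CutBound : ∀ {k} → GTreeConnected G k → CutBound k 0
  packing-CutBound {k} tc rep S s idem single _ = linear 0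
    (+-mono-≤ (packing-cut tc rep idem) (≤-reflexive (sym (all-crossing-degrees {rep} {S} single))))
    (arith (k * roots rep) (E all S) (cnt (S ∘ src) + cnt (S ∘ tgt)) (cnt (free-crosses rep S)) k (cnt (crosses rep)))
    where
    arith : ∀ r e d p k x → r + 1 * e + (x + k + (d + p)) + 0 ≡ d + 1 * p + k + 0 + (r + (x + e))
    arith = solve-∀

  -- With r ≥ 1 classes the trees give k(r - 1) crossing edges, and m(r - 1) is no larger.
  packing-roots : ∀ {k m} → GTreeConnected G k → m ≤ k → ∀ rep → Idempotent rep → m * roots rep ≤ cnt (crosses rep) + m
  packing-roots {k} {m} tc m≤k rep idem with roots rep | packing-cut tc rep idem
  ... | zero  | _  = subst (_≤ cnt (crosses rep) + m) (sym (*-zeroʳ m)) z≤n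
  ... | suc r | le = linear 0 (+-mono-≤ le (*-monoˡ-≤ r m≤k)) (arith m r k (cnt (crosses rep)))
    where
    arith : ∀ m r k x → m * (1 + r) + (x + k + k * r) + 0 ≡ x + m + (k * (1 + r) + m * r)
    arith = solve-∀

  -- Fewer than `k` boundary edges could be deleted, and no walk from `v` to `w` would survive.
  boundary : ∀ {k} → EdgeConnected G k → ∀ (B : VSet) v w → B v ≡ true → B w ≡ false →
             k ≤ cnt (λ e → B (src e) xor B (tgt e))
  boundary {k} ec B v w v∈B w∉B = ≮⇒≥ λ few → contra (reach-crosses (ec F (subst (_< k) (sym size) few) v w) B v∈B w∉B)
    where
    F : EdgeSet G
    F = tabulate λ e → B (src e) xor B (tgt e)
    lookup-F : ∀ e → lookup F e ≡ B (src e) xor B (tgt e)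
    lookup-F = lookup∘tabulate _
    size : ∣ F ∣ ≡ cnt (λ e → B (src e) xor B (tgt e))
    size = trans (card F) (cnt-cong lookup-F)
    contra : ¬ ∃ λ e → lookup (minus G F) e ≡ true × B (src e) xor B (tgt e) ≡ true
    contra (e , e∈ , x) = bool-contra e∈ (trans (lookup∘tabulate (λ e → not (lookup F e)) e) (cong not (trans (lookup-F e) x)))

  -- Each class avoiding `S` sends out at least `k` edges, and a crossing edge is counted once for
  -- each end whose class avoids `S`.
  boundaries : ∀ {k} → EdgeConnected G k → ∀ rep (S : VSet) → Idempotent rep →
    (∀ v → S v ≡ true → S (rep v) ≡ true) → (∀ t → rep t ≡ t → S t ≡ false → ∃ λ w → rep w ≢ t) →
    k * cnt (λ t → does (rep t ≟ t) ∧ not (S t)) ≤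
    cnt (λ e → crosses rep e ∧ not (S (src e))) + cnt (λ e → crosses rep e ∧ not (S (tgt e)))
  boundaries {k} ec rep S idem S-rep other = begin
    k * cnt (λ t → does (rep t ≟ t) ∧ not (S t))                 ≡⟨ trans (cong (k *_) (cnt-∑ _)) (sym (∑-* k _)) ⟩
    ∑ (λ t → k * ι (does (rep t ≟ t) ∧ not (S t)))               ≤⟨ ∑-mono each ⟩
    ∑ (λ t → cnt (λ e → at t e))                                 ≡⟨ ∑-cong (λ t → cnt-∑ _) ⟩
    ∑ (λ t → ∑ (λ e → ι (at t e)))                               ≡⟨ ∑-swap (λ t e → ι (at t e)) ⟩
    ∑ (λ e → ∑ (λ t → ι (at t e)))                               ≤⟨ ∑-mono (λ e → ≤-trans (≤-reflexive (sym (cnt-∑ _))) (both-ends e)) ⟩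
    ∑ (λ e → ι (crosses rep e ∧ not (S (src e))) + ι (crosses rep e ∧ not (S (tgt e))))  ≡⟨ ∑-+ _ _ ⟩
    ∑ (λ e → ι (crosses rep e ∧ not (S (src e)))) + ∑ (λ e → ι (crosses rep e ∧ not (S (tgt e))))
                                                                 ≡⟨ cong₂ _+_ (cnt-∑ _) (cnt-∑ _) ⟨
    cnt (λ e → crosses rep e ∧ not (S (src e))) + cnt (λ e → crosses rep e ∧ not (S (tgt e)))  ∎
    where
    open ≤-Reasoning
    at : Fin n → ESet
    at t e = not (S t) ∧ (does (rep (src e) ≟ t) xor does (rep (tgt e) ≟ t))

    each : ∀ t → k * ι (does (rep t ≟ t) ∧ not (S t)) ≤ cnt (at t)
    each t with rep t ≟ t | S t in t?S
    ... | no _     | _     = ≤-trans (≤-reflexive (*-zeroʳ k)) z≤n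
    ... | yes _    | true  = ≤-trans (≤-reflexive (*-zeroʳ k)) z≤n
    ... | yes rt≡t | false = let w , rw≢t = other t rt≡t t?S in
      subst (_≤ _) (sym (*-identityʳ k)) (boundary ec (λ v → does (rep v ≟ t)) t w (dec-true (rep t ≟ t) rt≡t) (dec-false (rep w ≟ t) rw≢t))

    both-ends : ∀ e → cnt (λ t → at t e) ≤ ι (crosses rep e ∧ not (S (src e))) + ι (crosses rep e ∧ not (S (tgt e)))
    both-ends e with rep (tgt e) ≟ rep (src e)
    ... | yes eq = ≤-reflexive (cnt-zero λ t → trans (cong (λ z → not (S t) ∧ (does (rep (src e) ≟ t) xor does (z ≟ t))) eq)
            (trans (cong (not (S t) ∧_) (xor-same (does (rep (src e) ≟ t)))) (∧-zeroʳ (not (S t)))))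
    ... | no _ = begin
      cnt (λ t → at t e)                                          ≡⟨ sym (+-identityʳ _) ⟩
      cnt (λ t → at t e) + 0                                      ≡⟨ cong (cnt (λ t → at t e) +_) (sym (cnt-zero λ _ → refl)) ⟩
      cnt (λ t → at t e) + cnt {n} (λ _ → false)                  ≤⟨ cnt-+-mono (λ t → bool (not (S t)) (does (rep (src e) ≟ t)) (does (rep (tgt e) ≟ t))) ⟩
      cnt (λ t → does (rep (src e) ≟ t) ∧ not (S t)) + cnt (λ t → does (rep (tgt e) ≟ t) ∧ not (S t))
                                                                  ≡⟨ cong₂ _+_ (cnt-singleton (rep (src e)) (not ∘ S)) (cnt-singleton (rep (tgt e)) (not ∘ S)) ⟩
      ι (not (S (rep (src e)))) + ι (not (S (rep (tgt e))))       ≤⟨ +-mono-≤ (ι-mono (contra (S-rep (src e)))) (ι-mono (contra (S-rep (tgt e)))) ⟩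
      ι (not (S (src e))) + ι (not (S (tgt e)))                   ∎
      where
      bool : ∀ s a b → ι (s ∧ (a xor b)) + 0 ≤ ι (a ∧ s) + ι (b ∧ s)
      bool = toWitness {a? = ∀Bool? λ s → ∀Bool? λ a → ∀Bool? λ b → ι (s ∧ (a xor b)) + 0 ℕ.≤? ι (a ∧ s) + ι (b ∧ s)} _
      contra : ∀ {a b} → (a ≡ true → b ≡ true) → not b ≡ true → not a ≡ true
      contra {false} h nb = refl
      contra {true}  h nb = bool-contra nb (cong not (h refl))

  -- With X crossing edges and R classes, the boundaries of the classes outside `S` give k(R - |S|)
  -- ≤ 2X - D, where D is the degree sum over `S`. Then X is eliminated by `all-crossing-degrees`.
  connected-CutBound : ∀ {k} → EdgeConnected G k → CutBound k 1
  connected-CutBound {k} ec rep S s idem single cntS = linear 0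
    (+-mono-≤ (+-mono-≤ (+-mono-≤ bound (*-monoʳ-≤ k S-roots)) (+-mono-≤ src-split tgt-split))
      (*-monoʳ-≤ 2 (≤-reflexive (sym (all-crossing-degrees {rep} {S} single)))))
    (trans (cong (λ z → k * z + 2 * E all S + (B + k * suc s + (X + X) + 2 * (cnt (S ∘ src) + cnt (S ∘ tgt) + P)) + 0) (cnt-split root S))
      (arith k (cnt (λ t → root t ∧ S t)) (cnt (λ t → root t ∧ not (S t))) (E all S)
        (cnt (λ e → crosses rep e ∧ not (S (src e)))) (cnt (λ e → crosses rep e ∧ not (S (tgt e)))) s X (cnt (S ∘ src)) (cnt (S ∘ tgt)) P))
    where
    root : VSet
    root t = does (rep t ≟ t)
    B X P : ℕ
    B = cnt (λ e → crosses rep e ∧ not (S (src e))) + cnt (λ e → crosses rep e ∧ not (S (tgt e)))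
    X = cnt (crosses rep)
    P = cnt (free-crosses rep S)

    S-rep : ∀ v → S v ≡ true → S (rep v) ≡ true
    S-rep v v∈S = subst (λ z → S z ≡ true) (sym (single v (rep v) v∈S (idem v))) v∈S

    bound : k * cnt (λ t → root t ∧ not (S t)) ≤ B
    bound = boundaries ec rep S idem S-rep λ t rt≡t t∉S →
      let v , v∈S = cnt-pos⁻¹ S (subst (0 <_) (sym cntS) (s≤s z≤n))
      in v , λ rv≡t → bool-contra v∈S (subst (λ z → S z ≡ false) (single v t v∈S (trans rt≡t (sym rv≡t))) t∉S)

    S-roots : cnt (λ t → root t ∧ S t) ≤ suc s
    S-roots = ≤-trans (cnt-mono λ t → ∧-trueʳ {root t}) (≤-reflexive cntS)

    src-split : cnt (S ∘ src) + cnt (λ e → crosses rep e ∧ not (S (src e))) ≤ X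
    src-split = ≤-trans (+-monoˡ-≤ _ (cnt-mono λ e h → ∧-true (src-crosses {S = S} single e h) h)) (≤-reflexive (sym (cnt-split (crosses rep) (S ∘ src))))

    tgt-split : cnt (S ∘ tgt) + cnt (λ e → crosses rep e ∧ not (S (tgt e))) ≤ X
    tgt-split = ≤-trans (+-monoˡ-≤ _ (cnt-mono λ e h → ∧-true (tgt-crosses {S = S} single e h) h)) (≤-reflexive (sym (cnt-split (crosses rep) (S ∘ tgt))))

    arith : ∀ k rs rn e b1 b2 s x d1 d2 p →
      k * (rs + rn) + 2 * e + (b1 + b2 + k * (1 + s) + (x + x) + 2 * (d1 + d2 + p)) + 0
      ≡ d1 + d2 + 2 * p + k + 1 * k * s + (k * rn + k * rs + (d1 + b1 + (d2 + b2)) + 2 * (x + e))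
    arith = solve-∀

  -- With at least two classes each has at least 2m boundary edges, and every crossing edge lies on
  -- two boundaries.
  connected-roots : ∀ {k m} → EdgeConnected G k → 2 * m ≤ k → ∀ rep → Idempotent rep → m * roots rep ≤ cnt (crosses rep) + m
  connected-roots {k} {m} ec 2m≤k rep idem with 2 ℕ.≤? roots rep
  ... | no ¬2≤ = ≤-trans (≤-trans (*-monoʳ-≤ m (≤-pred (≰⇒> ¬2≤))) (≤-reflexive (*-identityʳ m))) (m≤n+m m _)
  ... | yes 2≤ = ≤-trans (*-cancelˡ-≤ 2 (begin
      2 * (m * roots rep)              ≡⟨ *-assoc 2 m _ ⟨
      2 * m * roots rep                ≤⟨ *-monoˡ-≤ (roots rep) 2m≤k ⟩
      k * roots rep                    ≡⟨ cong (k *_) (cnt-cong λ t → sym (∧-identityʳ _)) ⟩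
      k * cnt (λ t → does (rep t ≟ t) ∧ true)  ≤⟨ boundaries ec rep (λ _ → false) idem (λ _ ()) (λ t _ _ → other t) ⟩
      cnt (λ e → crosses rep e ∧ true) + cnt (λ e → crosses rep e ∧ true)  ≡⟨ cong (λ z → z + z) (cnt-cong λ e → ∧-identityʳ (crosses rep e)) ⟩
      cnt (crosses rep) + cnt (crosses rep)    ≡⟨ cong (cnt (crosses rep) +_) (+-identityʳ _) ⟨
      2 * cnt (crosses rep)            ∎)) (m≤m+n _ m)
    where
    open ≤-Reasoning
    other : ∀ t → ∃ λ w → rep w ≢ t
    other t with Fin.any? (λ w → ¬? (rep w ≟ t))
    ... | yes found = found
    ... | no none   = ⊥-elim (<⇒≱ 2≤ (roots≤1 {rep} λ v w → trans (all-t v) (sym (all-t w))))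
      where
      all-t : ∀ v → rep v ≡ t
      all-t v with rep v ≟ t
      ... | yes eq = eq
      ... | no neq = ⊥-elim (none (v , neq))

-- Decidable certificates and construction of the subgraph.

module Existence {n} (G : Graph n) where
  open Sparsity G
  open Degrees G
  open Colouring G using (Colours; class; ∑-class; decompose)
  open Counting G
  open DegreeCount G
  open Cuts G

  Sparse? : ∀ m H → Dec (Sparse m H)
  Sparse? m H with anySubset? (λ A → Fin.any? λ v → (lookup A v Data.Bool.≟ true) ×-dec ¬? (E H (lookup A) + m ℕ.≤? m * cnt (lookup A)))
  ... | yes (A , v , v∈A , ¬≤) = no λ sp → ¬≤ (sp (lookup A) v v∈A)
  ... | no none = yes λ A v v∈A → subst₂ (λ a b → a + m ≤ m * b)
      (E-cong {H} {H} {lookup (tabulate A)} {A} (λ _ → refl) (lookup∘tabulate A)) (cnt-cong (lookup∘tabulate A))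
      (decidable-stable (_ ℕ.≤? _) λ ¬≤ → none (tabulate A , v , trans (lookup∘tabulate A v) v∈A , ¬≤))

  Packed : ∀ m → (Fin n → ℕ) → ESet → Colours m → Set
  Packed m η H c = (∀ i → Sparse 1 (class H c i)) × cnt H + m ≡ m * n × (∀ v → dg H v ≤ η v)

  Packed? : ∀ m η H c → Dec (Packed m η H c)
  Packed? m η H c = Fin.all? (λ i → Sparse? 1 (class H c i)) ×-dec (cnt H + m ℕ.≟ m * n) ×-dec Fin.all? (λ v → dg H v ℕ.≤? η v)

  Packed-cong : ∀ {m η H K c d} → (∀ e → H e ≡ K e) → (∀ e → c e ≡ d e) → Packed m η H c → Packed m η K d
  Packed-cong {m} {η} {H} {K} H≡K c≡d (sp , size , deg) =
    (λ i → Sparse-cong (λ e → cong₂ (λ h j → h ∧ does (j ≟ i)) (H≡K e) (c≡d e)) (sp i)) ,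
    trans (cong (_+ m) (sym (cnt-cong H≡K))) size ,
    λ v → subst (_≤ η v) (dg-cong v λ e _ → H≡K e) (deg v)

  -- Edge sets are coded as vectors and colourings as elements of `Fin (m ^ ne G)`, so an exhaustive
  -- search removes the double negation.
  find-packed : ∀ m η → ¬ ¬ (∃ λ H → ∃ (Packed m η H)) → ∃ λ (H : EdgeSet G) → ∃ (Packed m η (lookup H))
  find-packed m η ¬¬p with anySubset? {n = ne G} (λ H → Fin.any? {n = m ^ ne G} λ c → Packed? m η (lookup H) (finToFun c))
  ... | yes (H , c , p) = H , finToFun c , p
  ... | no none = ⊥-elim (¬¬p λ (H , c , p) → none (tabulate H , funToFin c ,
          Packed-cong (λ e → sym (lookup∘tabulate H e)) (λ e → sym (finToFun-funToFin c e)) p))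

  deg-dg : ∀ S v → deg G S v ≡ dg (lookup S) v
  deg-dg S v = trans (card (S ∩ˢ incident G v)) (trans (cnt-cong λ e →
    trans (lookup-zipWith _∧_ e S (incident G v)) (cong (lookup S e ∧_) (lookup∘tabulate (inc v) e))) (sym (dg-def _ v)))

  deg-allE : ∀ v → deg G (allE G) v ≡ dg all v
  deg-allE v = trans (deg-dg (allE G) v) (dg-cong v λ e _ → lookup∘tabulate all e)

  -- The set `W` of vertices known to be reachable from `x` grows along crossing edges until it
  -- contains `y`.
  tight⇒Connected : ∀ {T : ESet} → Sparse 1 T → Tight 1 T (λ _ → true) → Connected G (tabulate T)
  tight⇒Connected {T} sp tight x y = go (suc (cnt (not ∘ start))) start (dec-true (x ≟ x) refl)
      (λ v x≡v → subst (Reach G (tabulate T) x) (does-true (x ≟ v) x≡v) here) ≤-refl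
    where
    start : VSet
    start v = does (x ≟ v)

    go : ∀ N (W : VSet) → W x ≡ true → (∀ v → W v ≡ true → Reach G (tabulate T) x v) → cnt (not ∘ W) < N → Reach G (tabulate T) x y
    go (suc N) W x∈W reach (s≤s W≤N) with W y in y?W
    ... | true = reach y y?W
    ... | false with crossing-edge {Q = λ _ → true} {W} sp tight refl x∈W refl y?W
    ...   | e , e∈T , _ , crossing = cases (src e) (tgt e) (inj₁ (refl , refl)) (W (src e)) (W (tgt e)) refl refl crossing
      where
      extend : ∀ v w → Joins G e v w → W v ≡ true → W w ≡ false → Reach G (tabulate T) x y
      extend v w joins v∈W w∉W = go N W′ (∨-trueˡ x∈W) reach′ (<-≤-trans shrinks W≤N)
        where
        W′ : VSet
        W′ z = W z ∨ does (w ≟ z)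
        reach′ : ∀ z → W′ z ≡ true → Reach G (tabulate T) x z
        reach′ z z∈ with ∨-split {W z} z∈
        ... | inj₁ z∈W = reach z z∈W
        ... | inj₂ w≡z = subst (Reach G (tabulate T) x) (does-true (w ≟ z) w≡z)
                (step e (lookup⇒[]= e _ (trans (lookup∘tabulate T e) e∈T)) joins (reach v v∈W))
        shrinks : cnt (not ∘ W′) < cnt (not ∘ W)
        shrinks = cnt-mono-< {p = not ∘ W′} {not ∘ W} (λ z → not-∨ˡ (W z)) w (cong not (∨-trueʳ {W w} (dec-true (w ≟ w) refl))) (cong not w∉W)

      cases : ∀ v w → Joins G e v w → ∀ a b → W v ≡ a → W w ≡ b → a xor b ≡ true → Reach G (tabulate T) x y
      cases v w joins true  false v∈ w∉ _ = extend v w joins v∈ w∉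
      cases v w joins false true  v∉ w∈ _ = extend w v (swap-ends joins) w∈ v∉
        where
        swap-ends : ∀ {v w} → Joins G e v w → Joins G e w v
        swap-ends (inj₁ p) = inj₂ p
        swap-ends (inj₂ p) = inj₁ p

  -- Each of the `m` classes has at most n - 1 edges and together they have m(n - 1), so each has
  -- exactly n - 1 and is tight on the whole vertex set, hence connected.
  Packed⇒TreeConnected : ∀ {m η c} (H : EdgeSet G) → Fin n → Packed m η (lookup H) c → TreeConnected G m H
  Packed⇒TreeConnected {m} {η} {c} H v₀ (sp , size , _) = T , (λ i → (connected i , card-T i) , T⊆H i) , disjoint
    where
    C : Fin m → ESet
    C i = class (lookup H) c i

    T : Fin m → EdgeSet G
    T i = tabulate (C i)

    ∈T⇒C : ∀ i {e} → e ∈ˢ T i → C i e ≡ true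
    ∈T⇒C i {e} e∈T = trans (sym (lookup∘tabulate (C i) e)) ([]=⇒lookup e∈T)

    T⊆H : ∀ i {e} → e ∈ˢ T i → e ∈ˢ H
    T⊆H i {e} e∈T = lookup⇒[]= e H (∧-trueˡ {lookup H e} (∈T⇒C i e∈T))

    disjoint : ∀ i j e → e ∈ˢ T i → e ∈ˢ T j → i ≡ j
    disjoint i j e e∈Ti e∈Tj = trans (sym (colour i e∈Ti)) (colour j e∈Tj)
      where
      colour : ∀ i → e ∈ˢ T i → c e ≡ i
      colour i e∈T = does-true (c e ≟ i) (∧-trueʳ {lookup H e} (∈T⇒C i e∈T))

    bound : ∀ i → cnt (C i) + 1 ≤ n
    bound i = subst₂ (λ a b → a + 1 ≤ b) (E-all (C i)) (trans (*-identityˡ _) (cnt-all n)) (sp i (λ _ → true) v₀ refl)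

    total : ∑ (λ i → cnt (C i) + 1) ≡ ∑ {m} (λ _ → n)
    total = begin
      ∑ (λ i → cnt (C i) + 1)                          ≡⟨ ∑-+ _ _ ⟩
      ∑ (λ i → cnt (C i)) + ∑ {m} (λ _ → 1)            ≡⟨ cong₂ _+_ (∑-cong λ i → cnt-cong λ e → sym (∧-identityʳ (C i e))) (trans (∑-const m 1) (*-identityʳ m)) ⟩
      ∑ (λ i → cnt (λ e → C i e ∧ true)) + m           ≡⟨ cong (_+ m) (trans (∑-class (lookup H) c (λ _ → true)) (cnt-cong λ e → ∧-identityʳ _)) ⟩
      cnt (lookup H) + m                               ≡⟨ size ⟩
      m * n                                            ≡⟨ ∑-const m n ⟨
      ∑ {m} (λ _ → n)                                  ∎
      where open ≡-Reasoning

    exact : ∀ i → n ≤ cnt (C i) + 1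
    exact i = ≮⇒≥ λ less → <⇒≢ (∑-mono-< bound i less) total

    connected : ∀ i → Connected G (T i)
    connected i = tight⇒Connected (sp i) (subst₂ (λ a b → a ≤ b + 1) (sym (trans (*-identityˡ _) (cnt-all n))) (sym (E-all (C i))) (exact i))

    card-T : ∀ i → ∣ T i ∣ ≡ n ∸ 1
    card-T i = begin
      ∣ T i ∣                ≡⟨ trans (card (T i)) (cnt-cong (lookup∘tabulate (C i))) ⟩
      cnt (C i)              ≡⟨ m+n∸n≡m (cnt (C i)) 1 ⟨
      cnt (C i) + 1 ∸ 1      ≡⟨ cong (_∸ 1) (≤-antisym (bound i) (exact i)) ⟩
      n ∸ 1                  ∎
      where open ≡-Reasoning

  -- Among the full sparse sets one of least excess is chosen. A vertex above its bound would give
  -- an obstruction, which the count excludes, so this set can be split into forests.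
  packed : ∀ m k j a′ γ → .{{NonZero m}} → .{{_ : NonZero k}} → k ≡ j + suc a′ * m → (η : Fin n → ℕ) (u : Fin n) →
    CutBound k a′ → (∀ rep → Idempotent rep → m * roots rep ≤ cnt (crosses rep) + m) →
    (∀ H S s → Sparse m H → cnt S ≡ suc s → (∀ v → S v ≡ true → η v ≤ dg all v) → j * E H S ≤ γ * s) →
    (∀ v → m * dg all v + (γ + a′ * k * m) ≤ k * η v + (pred k + (γ + a′ * k * m)) * ι (does (u ≟ v))) →
    ∃ λ (H : EdgeSet G) → TreeConnected G m H × (∀ v → dg (lookup H) v ≤ η v)
  packed m k j a′ γ k≡ η u cut base-cut slack η-large =
    let H , c , p = find-packed m η exists in H , Packed⇒TreeConnected {m} {η} {c} H u p , proj₂ (proj₂ p)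
    where
    exists : ¬ ¬ (∃ λ H → ∃ (Packed m η H))
    exists = do
      H₀ , sp₀ , size₀ ← full-sparse m u base-cut
      H , (sp , size) , minimal ← argmin (λ H → Sparse m H × cnt H + m ≡ m * n) (excess η) H₀ (sp₀ , size₀)
      no ok ← em (∃ λ z → η z < dg H z)
        where yes (z , over) → do
                O ← Extremal.obstruction m η H sp (full H size) λ K (spK , sizeK) → minimal K (spK , trans (cong (_+ m) sizeK) size)
                λ _ → no-obstruction m k j a′ γ k≡ η u cut slack η-large sp size O z over
      c , sparse ← decompose H sp
      pure (H , c , sparse , size , λ v → ≮⇒≥ λ over → ok (v , over))
      where
      full : ∀ H → cnt H + m ≡ m * n → Tight m H (λ _ → true)
      full H size = subst₂ (λ a b → m * a ≤ b + m) (sym (cnt-all n)) (sym (E-all H)) (≤-reflexive (sym size))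

  -- At u the bound is the floor of m d(u) / k, elsewhere on X it is the ceiling of (m d(v) + β) / k.
  bounded-degrees : ∀ m k j a′ γ → .{{NonZero m}} → .{{_ : NonZero k}} → k ≡ j + suc a′ * m → (X : Subset n) (u : Fin n) →
    CutBound k a′ → (∀ rep → Idempotent rep → m * roots rep ≤ cnt (crosses rep) + m) →
    (∀ H S s → Sparse m H → cnt S ≡ suc s → (∀ v → S v ≡ true → v ∈ˢ X) → j * E H S ≤ γ * s) →
    ∃ λ (H : EdgeSet G) → TreeConnected G m H ×
      (∀ v → v ∈ˢ X → k * deg G H v ≤ m * deg G (allE G) v + (γ + a′ * k * m) + pred k) ×
      (u ∈ˢ X → deg G H u ≤ (m * deg G (allE G) u) / k)
  bounded-degrees m k j a′ γ k≡ X u cut base-cut slack =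
    let H , tc , le = packed m k j a′ γ k≡ η u cut base-cut slack′ η-large
    in H , tc ,
       (λ v v∈X → subst₂ (λ a b → k * a ≤ m * b + β + pred k) (sym (deg-dg H v)) (sym (deg-allE v))
         (≤-trans (≤-trans (*-monoʳ-≤ k (≤-trans (le v) (η-upper v ([]=⇒lookup v∈X)))) (≤-reflexive (*-comm k _))) (m/n*n≤m _ k))) ,
       (λ u∈X → subst₂ (λ a b → a ≤ (m * b) / k) (sym (deg-dg H u)) (sym (deg-allE u))
         (≤-trans (le u) (≤-reflexive (η-u ([]=⇒lookup u∈X)))))
    where
    β : ℕ
    β = γ + a′ * k * m

    d : Fin n → ℕ
    d = dg all

    η : Fin n → ℕ
    -- Off `X` the bound exceeds the degree in `G`, so a set `S` with η ≤ d on it lies in `X`. On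
    -- `X` the summand `pred k` turns the floor into a ceiling.
    η v = if lookup X v then (if does (u ≟ v) then (m * d v) / k else (m * d v + β + pred k) / k) else suc (m * d v + β + d v)

    η-u : lookup X u ≡ true → η u ≡ (m * d u) / k
    η-u u∈X rewrite u∈X | dec-true (u ≟ u) refl = refl

    η-upper : ∀ v → lookup X v ≡ true → η v ≤ (m * d v + β + pred k) / k
    η-upper v v∈X rewrite v∈X with does (u ≟ v)
    ... | true  = /-monoˡ-≤ k (≤-trans (m≤m+n (m * d v) β) (m≤m+n _ (pred k)))
    ... | false = ≤-refl

    floor : ∀ a → a ≤ k * (a / k) + pred k
    floor a = begin
      a                      ≡⟨ m≡m%n+[m/n]*n a k ⟩
      a % k + a / k * k      ≤⟨ +-mono-≤ (<⇒≤pred (m%n<n a k)) (≤-reflexive (*-comm (a / k) k)) ⟩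
      pred k + k * (a / k)   ≡⟨ +-comm (pred k) _ ⟩
      k * (a / k) + pred k   ∎
      where open ≤-Reasoning

    η-large : ∀ v → m * d v + β ≤ k * η v + (pred k + β) * ι (does (u ≟ v))
    η-large v with lookup X v | does (u ≟ v)
    ... | true  | true  = begin
      m * d v + β                                     ≤⟨ +-monoˡ-≤ β (floor (m * d v)) ⟩
      k * ((m * d v) / k) + pred k + β                ≡⟨ +-assoc (k * ((m * d v) / k)) (pred k) β ⟩
      k * ((m * d v) / k) + (pred k + β)              ≡⟨ cong ((k * ((m * d v) / k)) +_) (*-identityʳ _) ⟨
      k * ((m * d v) / k) + (pred k + β) * 1          ∎
      where open ≤-Reasoning
    ... | true  | false = +-cancelʳ-≤ (pred k) _ _ (≤-trans (floor (m * d v + β + pred k))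
            (≤-reflexive (cong (_+ pred k) (sym (trans (cong (k * ((m * d v + β + pred k) / k) +_) (*-zeroʳ (pred k + β))) (+-identityʳ _))))))
    ... | false | b     = begin
      m * d v + β                                     ≤⟨ m≤m+n _ (d v) ⟩
      m * d v + β + d v                               ≤⟨ n≤1+n _ ⟩
      suc (m * d v + β + d v)                         ≤⟨ m≤n*m _ k ⟩
      k * suc (m * d v + β + d v)                     ≤⟨ m≤m+n _ _ ⟩
      k * suc (m * d v + β + d v) + (pred k + β) * ι b ∎
      where open ≤-Reasoning

    slack′ : ∀ H S s → Sparse m H → cnt S ≡ suc s → (∀ v → S v ≡ true → η v ≤ d v) → j * E H S ≤ γ * s
    slack′ H S s sp cntS η≤d = slack H S s sp cntS λ v v∈S → lookup⇒[]= v X (inX v (η≤d v v∈S))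
      where
      inX : ∀ v → η v ≤ d v → lookup X v ≡ true
      inX v le with lookup X v
      ... | true  = refl
      ... | false = ⊥-elim (<⇒≱ (s≤s (m≤n+m (d v) (m * d v + β))) le)

  -- Sparsity applied to `S` itself, with |S| = s + 1.
  sparse-slack : ∀ {m j} H (S : VSet) s → Sparse m H → cnt S ≡ suc s → j * E H S ≤ j * m * s
  sparse-slack {m} {j} H S s sp cntS = ≤-trans (*-monoʳ-≤ j edges) (≤-reflexive (sym (*-assoc j m s)))
    where
    edges : E H S ≤ m * s
    edges = let v , v∈S = cnt-pos⁻¹ S (subst (0 <_) (sym cntS) (s≤s z≤n)) in
      +-cancelʳ-≤ m _ _ (≤-trans (sp S v v∈S) (≤-reflexive (trans (cong (m *_) cntS) (trans (*-suc m s) (+-comm m _)))))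

  independent-slack : ∀ {j s X} H (S : VSet) → Independent G X → (∀ v → S v ≡ true → v ∈ˢ X) → j * E H S ≤ 0 * s
  independent-slack {j} H S ind S⊆X = ≤-reflexive (trans (cong (j *_) (trans (E-def H S) (cnt-zero λ e → ¬true⇒false λ h →
    let e∈S = ∧-trueʳ {H e} h in ind e (S⊆X _ (∧-trueˡ {S (src e)} e∈S) , S⊆X _ (∧-trueʳ {S (src e)} e∈S))))) (*-zeroʳ j))

-- Integer ceilings and the four cases.

-- Opened only here: the constructor +_ makes sections such as (n +_) on ℕ ambiguous.
open import Data.Integer as ℤ using (ℤ; +_; _/ℕ_; _%ℕ_)
import Data.Integer.Properties as ℤ
open import Data.Integer.DivMod using (a≡a%ℕn+[a/ℕn]*n)
import Data.Integer.Tactic.RingSolver as ℤ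

-- The numerator may be negative, so it is given as a difference of naturals. If the claim failed,
-- `x` would be at least one more than the right side; multiplying by `k` and dividing -z with
-- remainder contradicts the hypothesis.
≤-⌈/⌉ : ∀ k .{{_ : NonZero k}} x p q c (z : ℤ) → z ≡ + p ℤ.- + q → k * x + q < p + k + k * c → + x ℤ.≤ ⌈ z / k ⌉ ℤ.+ + c
≤-⌈/⌉ k x p q c z z≡ lt with + x ℤ.≤? ⌈ z / k ⌉ ℤ.+ + c
... | yes le = le
... | no ¬le = ⊥-elim (<⇒≱ lt (ℤ.drop‿+≤+ (begin
  + (p + k + k * c)                                            ≡⟨ trans (ℤ.pos-+ (p + k) (k * c)) (cong₂ ℤ._+_ (ℤ.pos-+ p k) (ℤ.pos-* k c)) ⟩
  + p ℤ.+ + k ℤ.+ + k ℤ.* + c                                  ≤⟨ ℤ.i≤i+j _ (+ r) ⟩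
  + p ℤ.+ + k ℤ.+ + k ℤ.* + c ℤ.+ + r                          ≡⟨ regroup (+ p) (+ q) (+ k) (+ c) (+ r) ⟩
  (+ p ℤ.- + q) ℤ.+ + q ℤ.+ + k ℤ.+ + k ℤ.* + c ℤ.+ + r        ≡⟨ cong (λ w → w ℤ.+ + q ℤ.+ + k ℤ.+ + k ℤ.* + c ℤ.+ + r) p-q≡ ⟩
  ℤ.- (+ r ℤ.+ t ℤ.* + k) ℤ.+ + q ℤ.+ + k ℤ.+ + k ℤ.* + c ℤ.+ + r  ≡⟨ collect t (+ q) (+ k) (+ c) (+ r) ⟩
  ℤ.suc (ℤ.- t ℤ.+ + c) ℤ.* + k ℤ.+ + q                        ≤⟨ ℤ.+-monoˡ-≤ (+ q) (ℤ.*-monoʳ-≤-nonNeg (+ k) (ℤ.i<j⇒suc[i]≤j (ℤ.≰⇒> ¬le))) ⟩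
  + x ℤ.* + k ℤ.+ + q                                          ≡⟨ cong (ℤ._+ + q) (trans (ℤ.*-comm (+ x) (+ k)) (sym (ℤ.pos-* k x))) ⟩
  + (k * x) ℤ.+ + q                                            ≡⟨ ℤ.pos-+ (k * x) q ⟨
  + (k * x + q)                                                ∎)))
  where
  open ℤ.≤-Reasoning
  r : ℕ
  r = (ℤ.- z) %ℕ k
  t : ℤ
  t = (ℤ.- z) /ℕ k
  p-q≡ : + p ℤ.- + q ≡ ℤ.- (+ r ℤ.+ t ℤ.* + k)
  p-q≡ = trans (sym z≡) (trans (sym (ℤ.neg-involutive z)) (cong ℤ.-_ (a≡a%ℕn+[a/ℕn]*n (ℤ.- z) k)))
  regroup : ∀ p q k c r → p ℤ.+ k ℤ.+ k ℤ.* c ℤ.+ r ≡ (p ℤ.- q) ℤ.+ q ℤ.+ k ℤ.+ k ℤ.* c ℤ.+ r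
  regroup = ℤ.solve-∀
  collect : ∀ t q k c r → ℤ.- (r ℤ.+ t ℤ.* k) ℤ.+ q ℤ.+ k ℤ.+ k ℤ.* c ℤ.+ r ≡ (ℤ.1ℤ ℤ.+ (ℤ.- t ℤ.+ c)) ℤ.* k ℤ.+ q
  collect = ℤ.solve-∀

-- Since p + β = z + k c, the ceiling of (p + β)/k is that of z/k plus `c`.
≤-⌈/⌉-from-ℕ : ∀ k .{{_ : NonZero k}} {x p} β q c {z} → k * x ≤ p + β + pred k → q + β ≡ k * c →
               z ≡ + p ℤ.- + q → + x ℤ.≤ ⌈ z / k ⌉ ℤ.+ + c
≤-⌈/⌉-from-ℕ k {x} {p} β q c {z} le q+β≡kc z≡ = ≤-⌈/⌉ k x p q c z z≡
  (linear 0 (+-mono-≤ lt (≤-reflexive q+β≡kc)) (arith (k * x) q p β k (k * c)))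
  where
  lt : suc (k * x) ≤ p + β + k
  lt = ≤-trans (s≤s le) (≤-reflexive (trans (sym (+-suc (p + β) (pred k))) (cong (λ z → p + β + z) (suc-pred k))))
  arith : ∀ kx q p β k kc → 1 ℕ.+ (kx ℕ.+ q) ℕ.+ (p ℕ.+ β ℕ.+ k ℕ.+ kc) ℕ.+ 0 ≡ p ℕ.+ k ℕ.+ kc ℕ.+ (1 ℕ.+ kx ℕ.+ (q ℕ.+ β))
  arith = solve-∀

*-distribˡ-minus : ∀ m d c → + m ℤ.* (+ d ℤ.- + c) ≡ + (m * d) ℤ.- + (m * c)
*-distribˡ-minus m d c = trans (distrib (+ m) (+ d) (+ c)) (cong₂ ℤ._-_ (sym (ℤ.pos-* m d)) (sym (ℤ.pos-* m c)))
  where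
  distrib : ∀ m d c → m ℤ.* (d ℤ.- c) ≡ m ℤ.* d ℤ.- m ℤ.* c
  distrib = ℤ.solve-∀

-- The cases differ in two parameters: `a′` is 1 for edge-connectivity and 0 for tree-connectivity,
-- while `γ` is `j * m` in general and 0 for independent `X`.
good-subgraph : ∀ (k m : ℕ) → .{{_ : NonZero k}} → .{{_ : NonZero m}} →
  ∀ {n} (G : Graph n) (X : Subset n) (c : Case) → Hyp c G k m X → (u : Fin n) →
  ∃ λ H → Good c G k m X H × (u ∈ˢ X → deg G H u ≤ (m * deg G (allE G) u) / k)
good-subgraph k m G X c1 (ec , 2m≤k) u =
  let H , tc , le , floor = bounded-degrees m k j 1 (j * m) k≡ X u (connected-CutBound ec) (connected-roots ec 2m≤k)
                              (λ H S s sp cntS _ → sparse-slack {j = j} H S s sp cntS)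
  in H , (tc , λ v v∈X → ≤-⌈/⌉-from-ℕ k (j * m + 1 * k * m) (m * (2 * m)) (2 * m) (le v v∈X) (β≡ k k≡) (*-distribˡ-minus m _ (2 * m))) , floor
  where
  open Existence G
  open Cuts G
  j : ℕ
  j = k ∸ 2 * m
  k≡ : k ≡ j + 2 * m
  k≡ = sym (m∸n+n≡m 2m≤k)
  β≡ : ∀ K → K ≡ j + 2 * m → m * (2 * m) + (j * m + 1 * K * m) ≡ K * (2 * m)
  β≡ _ refl = arith j m
    where
    arith : ∀ j m → m * (2 * m) + (j * m + 1 * (j + 2 * m) * m) ≡ (j + 2 * m) * (2 * m)
    arith = solve-∀
good-subgraph k m G X c2 (tc , m≤k) u =
  let H , tc , le , floor = bounded-degrees m k j 0 (j * m) k≡ X u (packing-CutBound tc) (packing-roots tc m≤k)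
                              (λ H S s sp cntS _ → sparse-slack {j = j} H S s sp cntS)
  in H , (tc , λ v v∈X → ≤-⌈/⌉-from-ℕ k (j * m + 0 * k * m) (m * m) m (le v v∈X) (β≡ k k≡) (*-distribˡ-minus m _ m)) , floor
  where
  open Existence G
  open Cuts G
  j : ℕ
  j = k ∸ m
  k≡ : k ≡ j + 1 * m
  k≡ = trans (sym (m∸n+n≡m m≤k)) (cong (λ z → j + z) (sym (*-identityˡ m)))
  β≡ : ∀ K → K ≡ j + 1 * m → m * m + (j * m + 0 * K * m) ≡ K * m
  β≡ _ refl = arith j m
    where
    arith : ∀ j m → m * m + (j * m + 0) ≡ (j + 1 * m) * m
    arith = solve-∀
good-subgraph k m G X c3 (ec , 2m≤k , ind) u =
  let H , tc , le , floor = bounded-degrees m k (k ∸ 2 * m) 1 0 (sym (m∸n+n≡m 2m≤k)) X u (connected-CutBound ec) (connected-roots ec 2m≤k)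
                              (λ H S s _ _ S⊆X → independent-slack {j = k ∸ 2 * m} {s} H S ind S⊆X)
  in H , (tc , λ v v∈X → ≤-⌈/⌉-from-ℕ k (1 * k * m) 0 m (le v v∈X) (cong (_* m) (*-identityˡ k)) (sym (ℤ.+-identityʳ (+ (m * deg G (allE G) v))))) , floor
  where
  open Existence G
  open Cuts G
good-subgraph k m G X c4 (tc , m≤k , ind) u =
  let H , tc , le , floor = bounded-degrees m k (k ∸ m) 0 0 (trans (sym (m∸n+n≡m m≤k)) (cong (λ z → k ∸ m + z) (sym (*-identityˡ m)))) X u
                              (packing-CutBound tc) (packing-roots tc m≤k)
                              (λ H S s _ _ S⊆X → independent-slack {j = k ∸ m} {s} H S ind S⊆X)
  in H , (tc , λ v v∈X → subst (+ deg G H v ℤ.≤_) (ℤ.+-identityʳ _)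
            (≤-⌈/⌉-from-ℕ k 0 0 0 (le v v∈X) (sym (*-zeroʳ k)) (sym (ℤ.+-identityʳ (+ (m * deg G (allE G) v)))))) , floor
  where
  open Existence G
  open Cuts G

theorem6p15 : (k m : ℕ) → .{{_ : NonZero k}} → .{{_ : NonZero m}} →
    ∀ {n} (G : Graph n) (X : Subset n) (c : Case) → Hyp c G k m X →
    (Σ (EdgeSet G) λ H → Good c G k m X H) ×
    (∀ (u : Fin n) → u ∈ˢ X →
    Σ (EdgeSet G) λ H → Good c G k m X H ×
    deg G H u ≤ (m * deg G (allE G) u) / k)
theorem6p15 k m {n} G X c hyp = some n G X hyp ,
  λ u u∈X → let H , good , floor = good-subgraph k m G X c hyp u in H , good , floor u∈X
  where
  some : ∀ n (G : Graph n) (X : Subset n) → Hyp c G k m X → Σ (EdgeSet G) (Good c G k m X)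
  -- Without vertices no `u` can be chosen; the empty edge set works, as a spanning tree then has 0
  -- ∸ 1 = 0 edges.
  some zero    G X hyp = ∅ , ((λ _ → ∅) ,
    (λ i → ((λ ()) , trans (card ∅) (cnt-zero ∉∅)) , λ e∈ → e∈) ,
    λ i j e e∈ _ → bool-contra ([]=⇒lookup e∈) (∉∅ e)) , λ ()
    where
    ∅ : EdgeSet G
    ∅ = tabulate λ _ → false
    ∉∅ : ∀ e → lookup ∅ e ≡ false
    ∉∅ = lookup∘tabulate λ _ → false
  -- The claim about `u` is conditional on membership in `X`, so any vertex may serve as `u`.
  some (suc n) G X hyp = let H , good , _ = good-subgraph k m G X c hyp zero in H , good
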